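{- Let $p$ and $q$ be distinct prime numbers, both greater than $2$. Then the energy of the line graph $L(\Gamma(\mathbb{Z}_{pq}))$ is $4pq-8p-8q+16$.
   Context: For a positive integer $n$, $\mathbb{Z}_n$ is the ring of residue classes modulo $n$. The zero-divisor graph $\Gamma(\mathbb{Z}_n)$ is the simple undirected graph whose vertices are the nonzero zero-divisors of $\mathbb{Z}_n$ (nonzero $x \in \mathbb{Z}_n$ such that $xy = 0$ for some nonzero $y \in \mathbb{Z}_n$), with distinct vertices $x,y$ adjacent if and only if $xy=0$. The line graph $L(\Gamma(\mathbb{Z}_n))$ is the graph whose vertices are the edges of $\Gamma(\mathbb{Z}_n)$, two distinct vertices being adjacent if the corresponding edges share a common vertex in $\Gamma(\mathbb{Z}_n)$. The energy of a finite graph is the sum of the absolute values of the eigenvalues (counted with multiplicity) of its adjacency matrix. -}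

module Defs where

open import Algebra.Bundles.Raw using (RawMonoid)
import Algebra.Definitions.RawMonoid as RawMonoidOps
open import Data.Bool.Base using (if_then_else_)
open import Data.Fin.Base using (Fin; toℕ) renaming (_<_ to _<ᶠ_)
open import Data.Fin.Properties using (any?; _≟_) renaming (_<?_ to _<ᶠ?_)
open import Data.Integer.Base using (ℤ)
open import Data.List.Base using (List; allFin; cartesianProduct; filter; length; lookup)
open import Data.Nat.Base as ℕ using (ℕ; NonZero; _⊔_)
import Data.Nat.Properties as ℕ
open import Data.Nat.DivMod using (_mod_)
open import Data.Product.Base using (Σ-syntax; ∃-syntax; _×_; _,_)
open import Data.Product.Properties using (≡-dec)
open import Data.Rational.Base as ℚ using (ℚ; 0ℚ; 1ℚ; ½; _/_; 1/_; ∣_∣; positive; nonNegative)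
import Data.Rational.Properties as ℚ
open import Data.Rational.Solver using (module +-*-Solver)
open import Data.Sum.Base using (_⊎_; inj₁; inj₂)
open import Data.Vec.Functional using (Vector)
open import Function.Base using (_∘_)
open import Level using (0ℓ)
open import Relation.Binary.Core using (Rel)
open import Relation.Binary.Definitions using (Decidable; Irreflexive; Symmetric)
open import Relation.Binary.PropositionalEquality
open import Relation.Nullary using (¬_; ⌊_⌋)
open import Relation.Nullary.Decidable using (¬?; _×-dec_; _⊎-dec_)
open import Relation.Unary using (Pred)
import Relation.Unary as Unary

-- Real numbers are represented by Cauchy sequences of rationals, up to _≃_.
IsCauchy : (ℕ → ℚ) → Set
IsCauchy a = ∀ ε → 0ℚ ℚ.< ε →
  ∃[ N ] (∀ m n → N ℕ.≤ m → N ℕ.≤ n → ∣ a m ℚ.- a n ∣ ℚ.< ε)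

record ℝ : Set where
  constructor mkℝ
  field
    seq    : ℕ → ℚ
    cauchy : IsCauchy seq

open ℝ public

infix 4 _≃_
record _≃_ (x y : ℝ) : Set where
  constructor mk≃
  field
    close : ∀ ε → 0ℚ ℚ.< ε →
            ∃[ N ] (∀ n → N ℕ.≤ n → ∣ seq x n ℚ.- seq y n ∣ ℚ.< ε)

open _≃_ public

half-pos : ∀ {ε} → 0ℚ ℚ.< ε → 0ℚ ℚ.< ½ ℚ.* ε
half-pos {ε} 0<ε = subst (ℚ._< ½ ℚ.* ε) (ℚ.*-zeroʳ ½) (ℚ.*-monoʳ-<-pos ½ {0ℚ} {ε} 0<ε)

half+half : ∀ ε → ½ ℚ.* ε ℚ.+ ½ ℚ.* ε ≡ ε
half+half ε = trans (sym (ℚ.*-distribʳ-+ ε ½ ½)) (ℚ.*-identityˡ ε)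

*-mono-≤-< : ∀ a b c d → 0ℚ ℚ.≤ c → 0ℚ ℚ.< b → a ℚ.≤ b → c ℚ.< d → a ℚ.* c ℚ.< b ℚ.* d
*-mono-≤-< a b c d 0≤c 0<b a≤b c<d = ℚ.≤-<-trans
  (ℚ.*-monoʳ-≤-nonNeg c {{nonNegative 0≤c}} {a} {b} a≤b)
  (ℚ.*-monoʳ-<-pos b {{positive 0<b}} {c} {d} c<d)

∣p∣-∣q∣≤∣p-q∣ : ∀ p q → ∣ p ∣ ℚ.- ∣ q ∣ ℚ.≤ ∣ p ℚ.- q ∣
∣p∣-∣q∣≤∣p-q∣ p q = begin
  ∣ p ∣ ℚ.- ∣ q ∣                      ≡⟨ cong (λ r → ∣ r ∣ ℚ.- ∣ q ∣) (solve 2 (λ p q → p := (p :- q) :+ q) refl p q) ⟩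
  ∣ (p ℚ.- q) ℚ.+ q ∣ ℚ.- ∣ q ∣        ≤⟨ ℚ.+-monoˡ-≤ (ℚ.- ∣ q ∣) (ℚ.∣p+q∣≤∣p∣+∣q∣ (p ℚ.- q) q) ⟩
  (∣ p ℚ.- q ∣ ℚ.+ ∣ q ∣) ℚ.- ∣ q ∣    ≡⟨ solve 2 (λ a b → (a :+ b) :- b := a) refl ∣ p ℚ.- q ∣ ∣ q ∣ ⟩
  ∣ p ℚ.- q ∣                          ∎
  where open ℚ.≤-Reasoning
        open +-*-Solver

∣∣p∣-∣q∣∣≤∣p-q∣ : ∀ p q → ∣ ∣ p ∣ ℚ.- ∣ q ∣ ∣ ℚ.≤ ∣ p ℚ.- q ∣
∣∣p∣-∣q∣∣≤∣p-q∣ p q with ℚ.∣p∣≡p∨∣p∣≡-p (∣ p ∣ ℚ.- ∣ q ∣)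
... | inj₁ eq = subst (ℚ._≤ ∣ p ℚ.- q ∣) (sym eq) (∣p∣-∣q∣≤∣p-q∣ p q)
... | inj₂ eq = subst₂ ℚ._≤_ (trans (swap ∣ q ∣ ∣ p ∣) (sym eq))
                  (trans (cong ∣_∣ (swap q p)) (ℚ.∣-p∣≡∣p∣ (p ℚ.- q)))
                  (∣p∣-∣q∣≤∣p-q∣ q p)
  where
  open +-*-Solver
  swap : ∀ a b → a ℚ.- b ≡ ℚ.- (b ℚ.- a)
  swap = solve 2 (λ a b → a :- b := :- (b :- a)) refl

products-close : ∀ a b c d A B δ ε → 0ℚ ℚ.< A → 0ℚ ℚ.< B → A ℚ.* δ ℚ.+ B ℚ.* δ ≡ ε →
                 ∣ a ∣ ℚ.≤ A → ∣ d ∣ ℚ.≤ B →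
                 ∣ a ℚ.- c ∣ ℚ.< δ → ∣ b ℚ.- d ∣ ℚ.< δ →
                 ∣ (a ℚ.* b) ℚ.- (c ℚ.* d) ∣ ℚ.< ε
products-close a b c d A B δ ε 0<A 0<B eq a≤A d≤B a~c b~d = begin-strict
  ∣ (a ℚ.* b) ℚ.- (c ℚ.* d) ∣
    ≡⟨ cong ∣_∣ (solve 4 (λ a b c d → (a :* b) :- (c :* d) := (a :* (b :- d)) :+ (d :* (a :- c)))
         refl a b c d) ⟩
  ∣ a ℚ.* (b ℚ.- d) ℚ.+ d ℚ.* (a ℚ.- c) ∣
    ≤⟨ ℚ.∣p+q∣≤∣p∣+∣q∣ (a ℚ.* (b ℚ.- d)) (d ℚ.* (a ℚ.- c)) ⟩
  ∣ a ℚ.* (b ℚ.- d) ∣ ℚ.+ ∣ d ℚ.* (a ℚ.- c) ∣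
    ≡⟨ cong₂ ℚ._+_ (ℚ.∣p*q∣≡∣p∣*∣q∣ a (b ℚ.- d)) (ℚ.∣p*q∣≡∣p∣*∣q∣ d (a ℚ.- c)) ⟩
  ∣ a ∣ ℚ.* ∣ b ℚ.- d ∣ ℚ.+ ∣ d ∣ ℚ.* ∣ a ℚ.- c ∣
    <⟨ ℚ.+-mono-< {∣ a ∣ ℚ.* ∣ b ℚ.- d ∣} {A ℚ.* δ} {∣ d ∣ ℚ.* ∣ a ℚ.- c ∣} {B ℚ.* δ}
         (*-mono-≤-< (∣ a ∣) A (∣ b ℚ.- d ∣) δ (ℚ.0≤∣p∣ (b ℚ.- d)) 0<A a≤A b~d)
         (*-mono-≤-< (∣ d ∣) B (∣ a ℚ.- c ∣) δ (ℚ.0≤∣p∣ (a ℚ.- c)) 0<B d≤B a~c) ⟩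
  A ℚ.* δ ℚ.+ B ℚ.* δ
    ≡⟨ eq ⟩
  ε ∎
  where open ℚ.≤-Reasoning
        open +-*-Solver

quotient : ∀ a b ε → 0ℚ ℚ.< a → 0ℚ ℚ.< b → 0ℚ ℚ.< ε →
           ∃[ δ ] 0ℚ ℚ.< δ × a ℚ.* δ ℚ.+ b ℚ.* δ ≡ ε
quotient a b ε 0<a 0<b 0<ε =
  c⁻¹ ℚ.* ε , 0<c⁻¹ε , trans (sym (ℚ.*-distribʳ-+ (c⁻¹ ℚ.* ε) a b)) c*c⁻¹ε≡ε
  where
  c : ℚ
  c = a ℚ.+ b
  instance
    c-pos : ℚ.Positive c
    c-pos = positive (ℚ.+-mono-< {0ℚ} {a} {0ℚ} {b} 0<a 0<b)
    c-nonZero : ℚ.NonZero c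
    c-nonZero = ℚ.pos⇒nonZero c
  c⁻¹ : ℚ
  c⁻¹ = 1/ c
  0<c⁻¹ε : 0ℚ ℚ.< c⁻¹ ℚ.* ε
  0<c⁻¹ε = subst (ℚ._< c⁻¹ ℚ.* ε) (ℚ.*-zeroʳ c⁻¹)
             (ℚ.*-monoʳ-<-pos c⁻¹ {{ℚ.1/pos⇒pos c}} {0ℚ} {ε} 0<ε)
  c*c⁻¹ε≡ε : c ℚ.* (c⁻¹ ℚ.* ε) ≡ ε
  c*c⁻¹ε≡ε = trans (sym (ℚ.*-assoc c c⁻¹ ε))
    (trans (cong (ℚ._* ε) (ℚ.*-inverseʳ c)) (ℚ.*-identityˡ ε))

bounded : ∀ a → IsCauchy a → ∃[ B ] 0ℚ ℚ.< B × (∃[ N ] (∀ n → N ℕ.≤ n → ∣ a n ∣ ℚ.≤ B))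
bounded a a-cauchy =
  let N , closeᵃ = a-cauchy 1ℚ (ℚ.positive⁻¹ 1ℚ)
  in 1ℚ ℚ.+ ∣ a N ∣
   , ℚ.+-mono-<-≤ {0ℚ} {1ℚ} {0ℚ} {∣ a N ∣} (ℚ.positive⁻¹ 1ℚ) (ℚ.0≤∣p∣ (a N))
   , N , λ n N≤n → begin
     ∣ a n ∣                          ≡⟨ cong ∣_∣ (solve 2 (λ p q → p := (p :- q) :+ q) refl (a n) (a N)) ⟩
     ∣ (a n ℚ.- a N) ℚ.+ a N ∣        ≤⟨ ℚ.∣p+q∣≤∣p∣+∣q∣ (a n ℚ.- a N) (a N) ⟩
     ∣ a n ℚ.- a N ∣ ℚ.+ ∣ a N ∣      ≤⟨ ℚ.+-monoˡ-≤ ∣ a N ∣ (ℚ.<⇒≤ (closeᵃ n N N≤n ℕ.≤-refl)) ⟩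
     1ℚ ℚ.+ ∣ a N ∣                   ∎
  where open ℚ.≤-Reasoning
        open +-*-Solver

sums-close : ∀ a b c d ε → ∣ a ℚ.- c ∣ ℚ.< ½ ℚ.* ε → ∣ b ℚ.- d ∣ ℚ.< ½ ℚ.* ε →
             ∣ (a ℚ.+ b) ℚ.- (c ℚ.+ d) ∣ ℚ.< ε
sums-close a b c d ε a~c b~d = begin-strict
  ∣ (a ℚ.+ b) ℚ.- (c ℚ.+ d) ∣
    ≡⟨ cong ∣_∣ (solve 4 (λ a b c d → (a :+ b) :- (c :+ d) := (a :- c) :+ (b :- d)) refl a b c d) ⟩
  ∣ (a ℚ.- c) ℚ.+ (b ℚ.- d) ∣
    ≤⟨ ℚ.∣p+q∣≤∣p∣+∣q∣ (a ℚ.- c) (b ℚ.- d) ⟩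
  ∣ a ℚ.- c ∣ ℚ.+ ∣ b ℚ.- d ∣
    <⟨ ℚ.+-mono-< a~c b~d ⟩
  ½ ℚ.* ε ℚ.+ ½ ℚ.* ε
    ≡⟨ half+half ε ⟩
  ε ∎
  where open ℚ.≤-Reasoning
        open +-*-Solver

-- The witnesses N are never computed with, so they are kept from unfolding.
abstract
  const-cauchy : ∀ r → IsCauchy (λ _ → r)
  const-cauchy r ε 0<ε = 0 , λ _ _ _ _ →
    subst (ℚ._< ε) (cong ∣_∣ (sym (ℚ.+-inverseʳ r))) 0<ε

  +-cauchy : ∀ a b → IsCauchy a → IsCauchy b → IsCauchy (λ n → a n ℚ.+ b n)
  +-cauchy a b a-cauchy b-cauchy ε 0<ε =
    let M , closeᵃ = a-cauchy (½ ℚ.* ε) (half-pos 0<ε)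
        N , closeᵇ = b-cauchy (½ ℚ.* ε) (half-pos 0<ε)
    in M ⊔ N , λ m n ≤m ≤n →
      sums-close (a m) (b m) (a n) (b n) ε
        (closeᵃ m n (ℕ.m⊔n≤o⇒m≤o M N ≤m) (ℕ.m⊔n≤o⇒m≤o M N ≤n))
        (closeᵇ m n (ℕ.m⊔n≤o⇒n≤o M N ≤m) (ℕ.m⊔n≤o⇒n≤o M N ≤n))

  *-cauchy : ∀ a b → IsCauchy a → IsCauchy b → IsCauchy (λ n → a n ℚ.* b n)
  *-cauchy a b a-cauchy b-cauchy ε 0<ε =
    let A , 0<A , J , boundᵃ = bounded a a-cauchy
        B , 0<B , K , boundᵇ = bounded b b-cauchy
        δ , 0<δ , Aδ+Bδ≡ε    = quotient A B ε 0<A 0<B 0<ε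
        M , closeᵃ           = a-cauchy δ 0<δ
        N , closeᵇ           = b-cauchy δ 0<δ
    in (J ⊔ K) ⊔ (M ⊔ N) , λ m n ≤m ≤n →
      let jk≤m = ℕ.m⊔n≤o⇒m≤o (J ⊔ K) (M ⊔ N) ≤m
          mn≤m = ℕ.m⊔n≤o⇒n≤o (J ⊔ K) (M ⊔ N) ≤m
          jk≤n = ℕ.m⊔n≤o⇒m≤o (J ⊔ K) (M ⊔ N) ≤n
          mn≤n = ℕ.m⊔n≤o⇒n≤o (J ⊔ K) (M ⊔ N) ≤n
      in products-close (a m) (b m) (a n) (b n) A B δ ε 0<A 0<B Aδ+Bδ≡ε
           (boundᵃ m (ℕ.m⊔n≤o⇒m≤o J K jk≤m)) (boundᵇ n (ℕ.m⊔n≤o⇒n≤o J K jk≤n))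
           (closeᵃ m n (ℕ.m⊔n≤o⇒m≤o M N mn≤m) (ℕ.m⊔n≤o⇒m≤o M N mn≤n))
           (closeᵇ m n (ℕ.m⊔n≤o⇒n≤o M N mn≤m) (ℕ.m⊔n≤o⇒n≤o M N mn≤n))

  ∣∣-cauchy : ∀ a → IsCauchy a → IsCauchy (λ n → ∣ a n ∣)
  ∣∣-cauchy a a-cauchy ε 0<ε =
    let N , closeᵃ = a-cauchy ε 0<ε
    in N , λ m n ≤m ≤n → ℚ.≤-<-trans (∣∣p∣-∣q∣∣≤∣p-q∣ (a m) (a n)) (closeᵃ m n ≤m ≤n)

fromℚ : ℚ → ℝ
fromℚ r = mkℝ (λ _ → r) (const-cauchy r)

fromℤ : ℤ → ℝ
fromℤ z = fromℚ (z / 1)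

0ℝ 1ℝ : ℝ
0ℝ = fromℚ 0ℚ
1ℝ = fromℚ 1ℚ

infixl 6 _+ᴿ_
infixl 7 _*ᴿ_

_+ᴿ_ : ℝ → ℝ → ℝ
x +ᴿ y = mkℝ (λ n → seq x n ℚ.+ seq y n) (+-cauchy (seq x) (seq y) (cauchy x) (cauchy y))

_*ᴿ_ : ℝ → ℝ → ℝ
x *ᴿ y = mkℝ (λ n → seq x n ℚ.* seq y n) (*-cauchy (seq x) (seq y) (cauchy x) (cauchy y))

∣_∣ᴿ : ℝ → ℝ
∣ x ∣ᴿ = mkℝ (λ n → ∣ seq x n ∣) (∣∣-cauchy (seq x) (cauchy x))

+ᴿ-rawMonoid : RawMonoid 0ℓ 0ℓ
+ᴿ-rawMonoid = record { Carrier = ℝ ; _≈_ = _≃_ ; _∙_ = _+ᴿ_ ; ε = 0ℝ }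

-- k ×ᴿ x is the k-fold sum x + ⋯ + x.
open RawMonoidOps +ᴿ-rawMonoid public using () renaming (sum to sumᴿ; _×_ to _×ᴿ_)
open RawMonoidOps ℕ.+-0-rawMonoid public using () renaming (sum to sumᴺ)

infix 4 _≃ⱽ_
_≃ⱽ_ : ∀ {n} → Rel (Vector ℝ n) 0ℓ
v ≃ⱽ w = ∀ i → v i ≃ w i

0ⱽ : ∀ {n} → Vector ℝ n
0ⱽ _ = 0ℝ

infixr 7 _·ⱽ_ _·ᴹ_
_·ⱽ_ : ∀ {n} → ℝ → Vector ℝ n → Vector ℝ n
(c ·ⱽ v) i = c *ᴿ v i

Matrix : ℕ → Set
Matrix n = Fin n → Fin n → ℝ

_·ᴹ_ : ∀ {n} → Matrix n → Vector ℝ n → Vector ℝ n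
(A ·ᴹ v) i = sumᴿ λ j → A i j *ᴿ v j

combination : ∀ {n k} → Vector ℝ k → (Fin k → Vector ℝ n) → Vector ℝ n
combination c b i = sumᴿ λ j → c j *ᴿ b j i

record HasDimension {n} (W : Pred (Vector ℝ n) 0ℓ) (k : ℕ) : Set where
  field
    basis       : Fin k → Vector ℝ n
    inside      : ∀ j → W (basis j)
    independent : ∀ (c : Vector ℝ k) → combination c basis ≃ⱽ 0ⱽ → ∀ j → c j ≃ 0ℝ
    spanning    : ∀ v → W v → Σ[ c ∈ Vector ℝ k ] v ≃ⱽ combination c basis

Eigenspace : ∀ {n} → Matrix n → ℝ → Pred (Vector ℝ n) 0ℓ
Eigenspace A μ v = A ·ᴹ v ≃ⱽ μ ·ⱽ v

IsEigenvalue : ∀ {n} → Matrix n → ℝ → Set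
IsEigenvalue {n} A μ = Σ[ v ∈ Vector ℝ n ] ¬ (v ≃ⱽ 0ⱽ) × Eigenspace A μ v

-- The distinct eigenvalues of A, each with the dimension of its eigenspace as
-- its multiplicity.  For a real symmetric matrix all complex eigenvalues are
-- real and `total` is automatic; in general `total` forces A to be
-- diagonalisable over ℝ, so that geometric and algebraic multiplicities agree
-- and no eigenvalue is missed.
record Spectrum {n} (A : Matrix n) : Set where
  field
    size         : ℕ
    eigenvalue   : Fin size → ℝ
    multiplicity : Fin size → ℕ
    distinct     : ∀ i j → eigenvalue i ≃ eigenvalue j → i ≡ j
    sound        : ∀ i → IsEigenvalue A (eigenvalue i)
    complete     : ∀ μ → IsEigenvalue A μ → ∃[ i ] μ ≃ eigenvalue i
    dimension    : ∀ i → HasDimension (Eigenspace A (eigenvalue i)) (multiplicity i)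
    total        : sumᴺ multiplicity ≡ n

  absoluteSum : ℝ
  absoluteSum = sumᴿ λ i → multiplicity i ×ᴿ ∣ eigenvalue i ∣ᴿ

record Graph : Set₁ where
  field
    order  : ℕ
    Adj    : Rel (Fin order) 0ℓ
    adj?   : Decidable Adj
    irrefl : Irreflexive _≡_ Adj
    symm   : Symmetric Adj

adjacencyMatrix : (G : Graph) → Matrix (Graph.order G)
adjacencyMatrix G i j = if ⌊ Graph.adj? G i j ⌋ then 1ℝ else 0ℝ

-- "The energy of G is E": since eigenvalues cannot in general be listed
-- constructively, energy is a relation rather than a function.  It determines
-- E up to _≃_, the spectrum being unique up to reordering.
IsEnergy : Graph → ℝ → Set
IsEnergy G E = Σ[ S ∈ Spectrum (adjacencyMatrix G) ] Spectrum.absoluteSum S ≃ E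

module _ (G : Graph) where
  open Graph G

  -- Each undirected edge {i , j} is listed exactly once, as (i , j) with i < j.
  edges : List (Fin order × Fin order)
  edges = filter (λ (i , j) → (i <ᶠ? j) ×-dec adj? i j)
                 (cartesianProduct (allFin order) (allFin order))

  _∈ᴱ_ : Fin order → Fin order × Fin order → Set
  v ∈ᴱ (i , j) = v ≡ i ⊎ v ≡ j

  ShareVertex : Rel (Fin order × Fin order) 0ℓ
  ShareVertex e f = ∃[ v ] v ∈ᴱ e × v ∈ᴱ f

  shareVertex? : Decidable ShareVertex
  shareVertex? (i , j) (k , l) = any? λ v →
    ((v ≟ i) ⊎-dec (v ≟ j)) ×-dec ((v ≟ k) ⊎-dec (v ≟ l))

  lineGraph : Graph
  lineGraph = record
    { order  = length edges
    ; Adj    = λ a b → edge a ≢ edge b × ShareVertex (edge a) (edge b)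
    ; adj?   = λ a b → ¬? (≡-dec _≟_ _≟_ (edge a) (edge b)) ×-dec shareVertex? (edge a) (edge b)
    ; irrefl = λ { refl (a≢a , _) → a≢a refl }
    ; symm   = λ (a≢b , v , v∈a , v∈b) → (a≢b ∘ sym) , v , v∈b , v∈a
    }
    where
    edge : Fin (length edges) → Fin order × Fin order
    edge = lookup edges

-- Residue classes modulo n are represented by Fin n.
module _ (n : ℕ) .{{_ : NonZero n}} where

  0ₙ : Fin n
  0ₙ = 0 mod n

  infixl 7 _*ₙ_
  _*ₙ_ : Fin n → Fin n → Fin n
  x *ₙ y = (toℕ x ℕ.* toℕ y) mod n

  NonzeroZeroDivisor : Pred (Fin n) 0ℓ
  NonzeroZeroDivisor x = x ≢ 0ₙ × ∃[ y ] y ≢ 0ₙ × x *ₙ y ≡ 0ₙ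

  nonzeroZeroDivisor? : Unary.Decidable NonzeroZeroDivisor
  nonzeroZeroDivisor? x =
    ¬? (x ≟ 0ₙ) ×-dec any? λ y → ¬? (y ≟ 0ₙ) ×-dec (x *ₙ y ≟ 0ₙ)

  nonzeroZeroDivisors : List (Fin n)
  nonzeroZeroDivisors = filter nonzeroZeroDivisor? (allFin n)

  zeroDivisorGraph : Graph
  zeroDivisorGraph = record
    { order  = length nonzeroZeroDivisors
    ; Adj    = λ i j → element i ≢ element j × element i *ₙ element j ≡ 0ₙ
    ; adj?   = λ i j → ¬? (element i ≟ element j) ×-dec (element i *ₙ element j ≟ 0ₙ)
    ; irrefl = λ { refl (i≢i , _) → i≢i refl }
    ; symm   = λ {i} {j} (i≢j , ij≡0) → (i≢j ∘ sym) ,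
        trans (cong (_mod n) (ℕ.*-comm (toℕ (element j)) (toℕ (element i)))) ij≡0
    }
    where
    element : Fin (length nonzeroZeroDivisors) → Fin n
    element = lookup nonzeroZeroDivisors

{-# OPTIONS --safe #-}
-- Γ(ℤ_pq) is complete bipartite between the p − 1 nonzero multiples of q and the q − 1 nonzero
-- multiples of p, so its line graph is the rook's graph on an a × b board, a = p − 1 and b = q − 1.
-- An eigenvector v for μ satisfies (μ + 2) v i j = R i + C j, with R and C the row and column sums
-- of v.  Summing gives (μ + 2 − b) R i = T, (μ + 2 − a) C j = T and (μ + 2 − a − b) T = 0 for the
-- total T, so the eigenvalues are a + b − 2 (constant v), b − 2 (v constant along rows, T = 0),
-- a − 2 (v constant along columns, T = 0) and −2 (all row and column sums zero), of multiplicities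
-- 1, a − 1, b − 1 and (a − 1)(b − 1).  The energy is therefore 4 (a − 1)(b − 1).
module Submission where

open import Defs
open import Data.Integer.Base using (+_; _+_; _-_; _*_)
open import Data.Nat.Base as ℕ using (ℕ; _>_)
open import Data.Nat.Primality using (Prime; prime⇒nonZero)
open import Data.Nat.Properties using (m*n≢0)
open import Relation.Binary.PropositionalEquality using (_≢_)

open import Algebra.Bundles using (CommutativeRing)
open import Data.Bool.Base using (if_then_else_)
open import Data.Fin.Base using (Fin; zero; suc; toℕ; fromℕ<; combine; remQuot; _↑ˡ_; _↑ʳ_) renaming (_<_ to _<ᶠ_)
open import Data.Fin.Permutation using (Permutation; permutation; ↔⇒≡)
open import Data.Fin.Properties
  using (_≟_; 0≢1+n; suc-injective; <-cmp; <-asym; toℕ<n; toℕ-injective; toℕ-fromℕ<; remQuot-combine; combine-remQuot)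
  renaming (_<?_ to _<ᶠ?_)
open import Data.Integer.Base as ℤ using (ℤ; -[1+_])
import Data.Integer.Properties as ℤ
import Data.Integer.Solver as ℤ
open import Data.List.Base using (List; length; lookup; allFin; cartesianProduct)
open import Data.List.Membership.Propositional using (_∈_)
open import Data.List.Membership.Propositional.Properties
  using (∈-lookup; ∈-filter⁺; ∈-filter⁻; ∈-cartesianProduct⁺; ∈-allFin)
import Data.List.Relation.Unary.All as All
open import Data.List.Relation.Unary.AllPairs using (_∷_)
open import Data.List.Relation.Unary.Any using (index)
open import Data.List.Relation.Unary.Any.Properties using (lookup-index)
open import Data.List.Relation.Unary.Unique.Propositional using (Unique)
import Data.List.Relation.Unary.Unique.Propositional.Properties as Unique
open import Data.Nat.Base using (zero; suc; NonZero; s≤s)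
open import Data.Nat.Divisibility
  using (_∣_; divides; >⇒∤; m%n≡0⇒n∣m; n∣m⇒m%n≡0; m∣m*n; n∣m*n; *-pres-∣; ∣-trans)
open import Data.Nat.DivMod using (m%n<n)
open import Data.Nat.Primality using (prime⇒nonTrivial; prime⇒irreducible; euclidsLemma)
import Data.Nat.Properties as ℕ
import Data.Nat.Solver as ℕ
open import Data.Product.Base using (∃-syntax; ∃₂; _×_; _,_; proj₁; proj₂; uncurry)
open import Data.Rational.Base as ℚ using (ℚ; 0ℚ; 1ℚ; ½; _/_; ∣_∣; toℚᵘ)
import Data.Rational.Properties as ℚ
open import Data.Rational.Solver using (module +-*-Solver)
open import Data.Rational.Unnormalised.Base as ℚᵘ using (mkℚᵘ; *≡*)
import Data.Rational.Unnormalised.Properties as ℚᵘ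
open import Data.Sum.Base using (_⊎_; inj₁; inj₂; [_,_])
open import Data.Vec.Functional using (Vector)
open import Function.Base using (_∘_; _$_; flip)
open import Level using (0ℓ)
open import Relation.Binary.Definitions using (tri<; tri≈; tri>)
open import Relation.Binary.PropositionalEquality using (_≡_; refl; sym; trans; cong; cong₂; subst; subst₂; module ≡-Reasoning)
import Relation.Binary.Reasoning.Setoid as ≈-Reasoning
open import Relation.Nullary using (¬_; Dec; does; yes; no; contradiction; ⌊_⌋)
open import Relation.Nullary.Decidable using (dec-true; dec-false; _×-dec_)

-- Arithmetic and order of the Cauchy reals

-- The obstacle is constructive: equality of Cauchy reals is undecidable, yet `complete` must return
-- the index of the eigenvalue equal to a given μ. The row and column sum argument only excludes: if
-- 2 + μ differed from a + b, b, a and 0, the eigenvector would vanish. Two facts turn this into a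
-- choice. First, `_≃_` is the negation of apartness, hence stable under double negation, and a
-- factor that is merely not equal to zero can already be cancelled. Secondly, the candidates are
-- distinct rationals, and any real is provably different from one of two distinct rationals. The
-- hypotheses p, q > 2 make both sides of the board at least 2, so that all four multiplicities are
-- positive and each listed value really is an eigenvalue. The hypothesis p ≢ q keeps a - 2 and b -
-- 2 from merging into one eigenvalue with a larger eigenspace.

pointwise : ∀ {x y} → (∀ n → seq x n ≡ seq y n) → x ≃ y
pointwise {x} {y} eq = mk≃ λ ε 0<ε → 0 , λ n _ →
  subst (ℚ._< ε) (cong ∣_∣ (trans (sym (ℚ.+-inverseʳ (seq x n))) (cong (λ r → seq x n ℚ.- r) (eq n)))) 0<ε

≃-refl : ∀ {x} → x ≃ x
≃-refl = pointwise λ _ → refl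

∣p-q∣≡∣q-p∣ : ∀ p q → ∣ p ℚ.- q ∣ ≡ ∣ q ℚ.- p ∣
∣p-q∣≡∣q-p∣ p q = trans (sym (ℚ.∣-p∣≡∣p∣ (p ℚ.- q)))
  (cong ∣_∣ (solve 2 (λ p q → :- (p :- q) := q :- p) refl p q))
  where open +-*-Solver

≃-sym : ∀ {x y} → x ≃ y → y ≃ x
≃-sym {x} {y} x≃y = mk≃ λ ε 0<ε →
  let N , near = close x≃y ε 0<ε
  in N , λ n N≤n → subst (ℚ._< ε) (∣p-q∣≡∣q-p∣ (seq x n) (seq y n)) (near n N≤n)

-- The common skeleton of `≃-trans` and `+-cong`: beyond the larger of the two thresholds both
-- estimates hold. `D` stays arbitrary because each use bounds a different difference.
combine-close : ∀ {x y x′ y′} {D : ℕ → ℚ} δ ε → 0ℚ ℚ.< δ → x ≃ x′ → y ≃ y′ →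
  (∀ n → ∣ seq x n ℚ.- seq x′ n ∣ ℚ.< δ → ∣ seq y n ℚ.- seq y′ n ∣ ℚ.< δ → ∣ D n ∣ ℚ.< ε) →
  ∃[ N ] (∀ n → N ℕ.≤ n → ∣ D n ∣ ℚ.< ε)
combine-close δ ε 0<δ x≃x′ y≃y′ combine =
  let M , nearˣ = close x≃x′ δ 0<δ
      N , nearʸ = close y≃y′ δ 0<δ
  in M ℕ.⊔ N , λ n ≤n →
     combine n (nearˣ n (ℕ.m⊔n≤o⇒m≤o M N ≤n)) (nearʸ n (ℕ.m⊔n≤o⇒n≤o M N ≤n))

≃-trans : ∀ {x y z} → x ≃ y → y ≃ z → x ≃ z
≃-trans {x} {y} {z} x≃y y≃z = mk≃ λ ε 0<ε →
  -- Transitivity is the estimate for sums applied to x + y and y + z, since the middle term cancels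
  -- in their difference.
  combine-close (½ ℚ.* ε) ε (half-pos 0<ε) x≃y y≃z λ n x~y y~z →
    subst (λ r → ∣ r ∣ ℚ.< ε)
      (solve 3 (λ x y z → (x :+ y) :- (y :+ z) := x :- z) refl (seq x n) (seq y n) (seq z n))
      (sums-close (seq x n) (seq y n) (seq y n) (seq z n) ε x~y y~z)
  where open +-*-Solver

+-cong : ∀ {x x′ y y′} → x ≃ x′ → y ≃ y′ → x +ᴿ y ≃ x′ +ᴿ y′
+-cong {x} {x′} {y} {y′} x≃x′ y≃y′ = mk≃ λ ε 0<ε →
  combine-close (½ ℚ.* ε) ε (half-pos 0<ε) x≃x′ y≃y′ λ n →
    sums-close (seq x n) (seq y n) (seq x′ n) (seq y′ n) ε

-- The difference of products splits as x (y - y′) + y′ (x - x′), so the bounds needed are those of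
-- `x` and `y′`.
*-cong : ∀ {x x′ y y′} → x ≃ x′ → y ≃ y′ → x *ᴿ y ≃ x′ *ᴿ y′
*-cong {x} {x′} {y} {y′} x≃x′ y≃y′ = mk≃ λ ε 0<ε →
  let A , 0<A , J , boundᵃ = bounded (seq x) (cauchy x)
      B , 0<B , K , boundᵇ = bounded (seq y′) (cauchy y′)
      δ , 0<δ , eq         = quotient A B ε 0<A 0<B 0<ε
      M , nearˣ            = close x≃x′ δ 0<δ
      N , nearʸ            = close y≃y′ δ 0<δ
  in (J ℕ.⊔ K) ℕ.⊔ (M ℕ.⊔ N) , λ n ≤n →
     let jk≤n = ℕ.m⊔n≤o⇒m≤o (J ℕ.⊔ K) (M ℕ.⊔ N) ≤n
         mn≤n = ℕ.m⊔n≤o⇒n≤o (J ℕ.⊔ K) (M ℕ.⊔ N) ≤n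
     in products-close (seq x n) (seq y n) (seq x′ n) (seq y′ n) A B δ ε 0<A 0<B eq
          (boundᵃ n (ℕ.m⊔n≤o⇒m≤o J K jk≤n)) (boundᵇ n (ℕ.m⊔n≤o⇒n≤o J K jk≤n))
          (nearˣ n (ℕ.m⊔n≤o⇒m≤o M N mn≤n)) (nearʸ n (ℕ.m⊔n≤o⇒n≤o M N mn≤n))

infix 8 -ᴿ_
-- As a product with -1, negation inherits its Cauchy proof and its congruence from multiplication.
-ᴿ_ : ℝ → ℝ
-ᴿ x = fromℚ (ℚ.- 1ℚ) *ᴿ x

-- The operations act term by term, so every law is inherited from ℚ through `pointwise`; only the
-- congruences need estimates.
ℝ-commutativeRing : CommutativeRing 0ℓ 0ℓ
ℝ-commutativeRing = record
  { Carrier = ℝ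
  ; _≈_ = _≃_
  ; _+_ = _+ᴿ_
  ; _*_ = _*ᴿ_
  ; -_ = -ᴿ_
  ; 0# = 0ℝ
  ; 1# = 1ℝ
  ; isCommutativeRing = record
    { isRing = record
      { +-isAbelianGroup = record
        { isGroup = record
          { isMonoid = record
            { isSemigroup = record
              { isMagma = record
                { isEquivalence = record { refl = ≃-refl ; sym = ≃-sym ; trans = ≃-trans }
                ; ∙-cong = +-cong
                }
              ; assoc = λ x y z → pointwise λ n → ℚ.+-assoc (seq x n) (seq y n) (seq z n)
              }
            ; identity = (λ x → pointwise λ n → ℚ.+-identityˡ (seq x n))
                       , (λ x → pointwise λ n → ℚ.+-identityʳ (seq x n))
            }
          ; inverse = (λ x → pointwise λ n → solve 1 (λ x → con (ℚ.- 1ℚ) :* x :+ x := con 0ℚ) refl (seq x n))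
                    , (λ x → pointwise λ n → solve 1 (λ x → x :+ con (ℚ.- 1ℚ) :* x := con 0ℚ) refl (seq x n))
          ; ⁻¹-cong = *-cong ≃-refl
          }
        ; comm = λ x y → pointwise λ n → ℚ.+-comm (seq x n) (seq y n)
        }
      ; *-cong = *-cong
      ; *-assoc = λ x y z → pointwise λ n → ℚ.*-assoc (seq x n) (seq y n) (seq z n)
      ; *-identity = (λ x → pointwise λ n → ℚ.*-identityˡ (seq x n))
                   , (λ x → pointwise λ n → ℚ.*-identityʳ (seq x n))
      ; distrib = (λ x y z → pointwise λ n → ℚ.*-distribˡ-+ (seq x n) (seq y n) (seq z n))
                , (λ x y z → pointwise λ n → ℚ.*-distribʳ-+ (seq x n) (seq y n) (seq z n))
      }
    ; *-comm = λ x y → pointwise λ n → ℚ.*-comm (seq x n) (seq y n)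
    }
  }
  where open +-*-Solver

-- Apartness from zero and constructive substitutes for case distinction.

infix 4 _#0
-- The positive form of being nonzero: it carries a rational lower bound, which `¬ x ≃ 0ℝ` does not
-- supply.
_#0 : ℝ → Set
x #0 = ∃[ δ ] 0ℚ ℚ.< δ × ∃[ N ] (∀ n → N ℕ.≤ n → δ ℚ.< ∣ seq x n ∣)

half-< : ∀ {ε} → 0ℚ ℚ.< ε → ½ ℚ.* ε ℚ.< ε
half-< {ε} 0<ε = subst₂ ℚ._<_ (ℚ.+-identityʳ (½ ℚ.* ε)) (half+half ε)
  (ℚ.+-monoʳ-< (½ ℚ.* ε) (half-pos 0<ε))

∣p∣≤∣p-q∣+∣q∣ : ∀ p q → ∣ p ∣ ℚ.≤ ∣ p ℚ.- q ∣ ℚ.+ ∣ q ∣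
∣p∣≤∣p-q∣+∣q∣ p q = subst (λ r → ∣ r ∣ ℚ.≤ ∣ p ℚ.- q ∣ ℚ.+ ∣ q ∣)
  (solve 2 (λ p q → (p :- q) :+ q := p) refl p q) (ℚ.∣p+q∣≤∣p∣+∣q∣ (p ℚ.- q) q)
  where open +-*-Solver

-- Only a rational comparison is decided. Fix an index N after which terms differ by less than ε/4
-- and compare the N-th term with ε/2: below it, all later terms stay under ε; otherwise they all
-- exceed ε/4.
small-or-apart : ∀ x ε → 0ℚ ℚ.< ε → (∃[ N ] (∀ n → N ℕ.≤ n → ∣ seq x n ∣ ℚ.< ε)) ⊎ x #0
small-or-apart x ε 0<ε with cauchy x (½ ℚ.* (½ ℚ.* ε)) (half-pos {½ ℚ.* ε} (half-pos 0<ε))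
... | N , near with ∣ seq x N ∣ ℚ.<? ½ ℚ.* ε
...   | yes small = inj₁ (N , λ n N≤n → begin-strict
          ∣ seq x n ∣                              ≤⟨ ∣p∣≤∣p-q∣+∣q∣ (seq x n) (seq x N) ⟩
          ∣ seq x n ℚ.- seq x N ∣ ℚ.+ ∣ seq x N ∣  <⟨ ℚ.+-mono-< (ℚ.<-trans (near n N N≤n ℕ.≤-refl) (half-< (half-pos 0<ε))) small ⟩
          ½ ℚ.* ε ℚ.+ ½ ℚ.* ε                      ≡⟨ half+half ε ⟩
          ε                                        ∎)
  where open ℚ.≤-Reasoning
...   | no large = inj₂ (η , half-pos {½ ℚ.* ε} (half-pos 0<ε) , N , λ n N≤n → ℚ.≰⇒> λ ∣xₙ∣≤η → large (begin-strict
          ∣ seq x N ∣                              ≤⟨ ∣p∣≤∣p-q∣+∣q∣ (seq x N) (seq x n) ⟩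
          ∣ seq x N ℚ.- seq x n ∣ ℚ.+ ∣ seq x n ∣  <⟨ ℚ.+-mono-<-≤ (near N n ℕ.≤-refl N≤n) ∣xₙ∣≤η ⟩
          η ℚ.+ η                                  ≡⟨ half+half (½ ℚ.* ε) ⟩
          ½ ℚ.* ε                                  ∎))
  where open ℚ.≤-Reasoning
        η = ½ ℚ.* (½ ℚ.* ε)

#0⇒≄0 : ∀ {x} → x #0 → ¬ x ≃ 0ℝ
#0⇒≄0 {x} (δ , 0<δ , M , apart) x≃0 =
  let N , near = close x≃0 δ 0<δ
      n        = M ℕ.⊔ N
  in ℚ.<-asym (apart n (ℕ.m≤m⊔n M N))
       (subst (λ r → ∣ r ∣ ℚ.< δ) (ℚ.+-identityʳ (seq x n)) (near n (ℕ.m≤n⊔m M N)))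

-- With apartness refuted, `small-or-apart` must give its first alternative for every ε.
¬#0⇒≃0 : ∀ {x} → ¬ x #0 → x ≃ 0ℝ
¬#0⇒≃0 {x} ¬x#0 = mk≃ λ ε 0<ε → eventually ε (small-or-apart x ε 0<ε)
  where
  eventually : ∀ ε → (∃[ N ] (∀ n → N ℕ.≤ n → ∣ seq x n ∣ ℚ.< ε)) ⊎ x #0 →
               ∃[ N ] (∀ n → N ℕ.≤ n → ∣ seq x n ℚ.- 0ℚ ∣ ℚ.< ε)
  eventually ε (inj₁ (N , small)) = N , λ n N≤n →
    subst (λ r → ∣ r ∣ ℚ.< ε) (sym (ℚ.+-identityʳ (seq x n))) (small n N≤n)
  eventually ε (inj₂ x#0) = contradiction x#0 ¬x#0

-- It suffices to refute that `y` is apart from 0. If its terms eventually exceed δ in absolute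
-- value, then a product below ε δ forces the factor from `x` below ε, so `x` would be zero.
x*y≃0⇒y≃0 : ∀ {x y} → ¬ x ≃ 0ℝ → x *ᴿ y ≃ 0ℝ → y ≃ 0ℝ
x*y≃0⇒y≃0 {x} {y} x≄0 xy≃0 = ¬#0⇒≃0 λ (δ , 0<δ , M , apart) → x≄0 (mk≃ λ ε 0<ε →
  let instance ε-nonNeg = ℚ.nonNegative (ℚ.<⇒≤ 0<ε)
      0<εδ = subst (ℚ._< ε ℚ.* δ) (ℚ.*-zeroʳ ε) (ℚ.*-monoʳ-<-pos ε {{ℚ.positive 0<ε}} 0<δ)
      N , near = close xy≃0 (ε ℚ.* δ) 0<εδ
  in M ℕ.⊔ N , λ n ≤n → ℚ.≰⇒> λ ε≤∣x∣ → ℚ.<-irrefl refl (begin-strict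
    ε ℚ.* δ                          ≤⟨ ℚ.*-monoˡ-≤-nonNeg ε (ℚ.<⇒≤ (apart n (ℕ.m⊔n≤o⇒m≤o M N ≤n))) ⟩
    ε ℚ.* ∣ seq y n ∣                ≤⟨ ℚ.*-monoʳ-≤-nonNeg ∣ seq y n ∣ {{ℚ.∣-∣-nonNeg (seq y n)}} ε≤∣x∣ ⟩
    ∣ seq x n ℚ.- 0ℚ ∣ ℚ.* ∣ seq y n ∣
      ≡⟨ cong (λ r → ∣ r ∣ ℚ.* ∣ seq y n ∣) (ℚ.+-identityʳ (seq x n)) ⟩
    ∣ seq x n ∣ ℚ.* ∣ seq y n ∣      ≡⟨ ℚ.∣p*q∣≡∣p∣*∣q∣ (seq x n) (seq y n) ⟨
    ∣ seq x n ℚ.* seq y n ∣          ≡⟨ cong ∣_∣ (ℚ.+-identityʳ (seq x n ℚ.* seq y n)) ⟨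
    ∣ seq x n ℚ.* seq y n ℚ.- 0ℚ ∣   <⟨ near n (ℕ.m⊔n≤o⇒n≤o M N ≤n) ⟩
    ε ℚ.* δ                          ∎))
  where open ℚ.≤-Reasoning


open CommutativeRing ℝ-commutativeRing using (semiring; +-group) renaming (setoid to ≃-setoid)
open import Algebra.Properties.Group +-group using (x∙y⁻¹≈ε⇒x≈y; x≈y⇒x∙y⁻¹≈ε) renaming (∙-cancelˡ to +-cancelˡ)
open import Algebra.Properties.Semiring.Mult semiring using (×-congʳ; ×-assoc-*)
open import Algebra.Properties.Semiring.Sum semiring
  using (sum-cong-≋; sum-replicate; sum-replicate-zero; ∑-distrib-+; ∑-comm; sum-permute; *-distribˡ-sum; *-distribʳ-sum)

x-y≃0⇒x≃y : ∀ {x y} → x +ᴿ -ᴿ y ≃ 0ℝ → x ≃ y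
x-y≃0⇒x≃y {x} {y} = x∙y⁻¹≈ε⇒x≈y x y

¬¬-≃ : ∀ {x y} → ¬ ¬ x ≃ y → x ≃ y
¬¬-≃ {x} {y} ¬¬x≃y = x-y≃0⇒x≃y (¬#0⇒≃0 λ x-y#0 →
  ¬¬x≃y (#0⇒≄0 x-y#0 ∘ x≈y⇒x∙y⁻¹≈ε {x} {y}))

x*z≃y*z⇒z≃0 : ∀ {x y z} → ¬ x ≃ y → x *ᴿ z ≃ y *ᴿ z → z ≃ 0ℝ
x*z≃y*z⇒z≃0 {x} {y} {z} x≄y xz≃yz = x*y≃0⇒y≃0 (x≄y ∘ x-y≃0⇒x≃y)
  (≃-trans (pointwise λ n → solve 3 (λ x y z → (x :+ con (ℚ.- 1ℚ) :* y) :* z := x :* z :+ con (ℚ.- 1ℚ) :* (y :* z))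
                               refl (seq x n) (seq y n) (seq z n))
           (x≈y⇒x∙y⁻¹≈ε {x *ᴿ z} {y *ᴿ z} xz≃yz))
  where open +-*-Solver

p≢q⇒0<∣p-q∣ : ∀ {p q} → p ≢ q → 0ℚ ℚ.< ∣ p ℚ.- q ∣
p≢q⇒0<∣p-q∣ {p} {q} p≢q = ℚ.≰⇒> λ ∣p-q∣≤0 → p≢q
  (x∙y⁻¹≈ε⇒x≈y′ p q (ℚ.∣p∣≡0⇒p≡0 (p ℚ.- q) (ℚ.≤-antisym ∣p-q∣≤0 (ℚ.0≤∣p∣ (p ℚ.- q)))))
  where open import Algebra.Properties.Group ℚ.+-0-group using () renaming (x∙y⁻¹≈ε⇒x≈y to x∙y⁻¹≈ε⇒x≈y′)

fromℚ-injective : ∀ {r s} → fromℚ r ≃ fromℚ s → r ≡ s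
fromℚ-injective {r} {s} r≃s with r ℚ.≟ s
... | yes r≡s = r≡s
... | no  r≢s =
  let N , near = close r≃s ∣ r ℚ.- s ∣ (p≢q⇒0<∣p-q∣ r≢s)
  in contradiction (near N ℕ.≤-refl) (ℚ.<-irrefl refl)

-- Test x - r against half the distance from `r` to `s`: a real that stays within it of `r` cannot
-- converge to `s`, and otherwise x - r is apart from 0.
≄-cotransitive : ∀ {r s} → r ≢ s → ∀ x → ¬ x ≃ fromℚ r ⊎ ¬ x ≃ fromℚ s
≄-cotransitive {r} {s} r≢s x = cases
  (small-or-apart (x +ᴿ fromℚ (ℚ.- r)) (½ ℚ.* d) 0<½d)
  where
  open ℚ.≤-Reasoning
  d = ∣ r ℚ.- s ∣
  0<½d : 0ℚ ℚ.< ½ ℚ.* d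
  0<½d = half-pos {d} (p≢q⇒0<∣p-q∣ {r} {s} r≢s)

  cases : ∃[ N ] (∀ n → N ℕ.≤ n → ∣ seq x n ℚ.- r ∣ ℚ.< ½ ℚ.* d) ⊎ x +ᴿ fromℚ (ℚ.- r) #0 →
          ¬ x ≃ fromℚ r ⊎ ¬ x ≃ fromℚ s
  cases (inj₂ x-r#0) = inj₁ λ x≃r → #0⇒≄0 x-r#0
    (≃-trans (+-cong {y = fromℚ (ℚ.- r)} x≃r ≃-refl) (pointwise λ _ → ℚ.+-inverseʳ r))
  cases (inj₁ (M , near-r)) = inj₂ λ x≃s →
    let N , near-s = close x≃s (½ ℚ.* d) 0<½d
        n          = M ℕ.⊔ N
    in ℚ.<-irrefl refl (begin-strict
      ∣ r ℚ.- s ∣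
        ≤⟨ ∣p∣≤∣p-q∣+∣q∣ (r ℚ.- s) (seq x n ℚ.- s) ⟩
      ∣ (r ℚ.- s) ℚ.- (seq x n ℚ.- s) ∣ ℚ.+ ∣ seq x n ℚ.- s ∣
        ≡⟨ cong (λ t → ∣ t ∣ ℚ.+ ∣ seq x n ℚ.- s ∣)
             (solve 3 (λ x r s → (r :- s) :- (x :- s) := r :- x) refl (seq x n) r s) ⟩
      ∣ r ℚ.- seq x n ∣ ℚ.+ ∣ seq x n ℚ.- s ∣
        ≡⟨ cong (ℚ._+ ∣ seq x n ℚ.- s ∣) (∣p-q∣≡∣q-p∣ r (seq x n)) ⟩
      ∣ seq x n ℚ.- r ∣ ℚ.+ ∣ seq x n ℚ.- s ∣
        <⟨ ℚ.+-mono-< (near-r n (ℕ.m≤m⊔n M N)) (near-s n (ℕ.m≤n⊔m M N)) ⟩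
      ½ ℚ.* d ℚ.+ ½ ℚ.* d
        ≡⟨ half+half d ⟩
      d ∎)
    where open +-*-Solver

⊎-distrib-∀ : ∀ {k} {A : Set} {B : Fin k → Set} → (∀ i → A ⊎ B i) → A ⊎ (∀ i → B i)
⊎-distrib-∀ {zero}  f = inj₂ λ ()
⊎-distrib-∀ {suc k} f with f zero | ⊎-distrib-∀ (f ∘ suc)
... | inj₁ a | _      = inj₁ a
... | inj₂ _ | inj₁ a = inj₁ a
... | inj₂ b | inj₂ g = inj₂ λ { zero → b ; (suc i) → g i }

-- Cotransitivity at distinct rationals replaces excluded middle: it rules out either r 0 or
-- all the other r i.
¬∀≄⇒∃≃ : ∀ {k} (r : Fin k → ℚ) → (∀ i j → r i ≡ r j → i ≡ j) →
  ∀ x → ¬ (∀ i → ¬ x ≃ fromℚ (r i)) → ∃[ i ] x ≃ fromℚ (r i)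
¬∀≄⇒∃≃ {zero}  r r-injective x ¬∀ = contradiction (λ ()) ¬∀
¬∀≄⇒∃≃ {suc k} r r-injective x ¬∀ =
  cases (⊎-distrib-∀ λ i → ≄-cotransitive (0≢1+n ∘ r-injective zero (suc i)) x)
  where
  cases : ¬ x ≃ fromℚ (r zero) ⊎ (∀ i → ¬ x ≃ fromℚ (r (suc i))) → ∃[ i ] x ≃ fromℚ (r i)
  -- With the later candidates excluded, excluding `r zero` as well would contradict `¬∀`; stability
  -- removes the double negation.
  cases (inj₂ x≄rᵢ₊₁) = zero , ¬¬-≃ λ x≄r₀ → ¬∀ λ { zero → x≄r₀ ; (suc i) → x≄rᵢ₊₁ i }
  cases (inj₁ x≄r₀)   =
    let i , x≃rᵢ₊₁ = ¬∀≄⇒∃≃ (r ∘ suc) (λ i j eq → suc-injective (r-injective (suc i) (suc j) eq)) x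
                       (λ x≄rᵢ₊₁ → ¬∀ λ { zero → x≄r₀ ; (suc i) → x≄rᵢ₊₁ i })
    in suc i , x≃rᵢ₊₁

-- Integers inside the rationals and the reals.

/1-homo-+ : ∀ z w → (z ℤ.+ w) / 1 ≡ z / 1 ℚ.+ w / 1
/1-homo-+ z w = ℚ.toℚᵘ-injective (begin
  -- The fraction `z / 1` is normalised by a gcd that does not compute for a variable `z`, so the
  -- identity is checked on unnormalised fractions.
  toℚᵘ ((z ℤ.+ w) / 1)             ≈⟨ ℚ.toℚᵘ-fromℚᵘ (mkℚᵘ (z ℤ.+ w) 0) ⟩
  mkℚᵘ (z ℤ.+ w) 0                 ≈⟨ *≡* (cong (ℤ._* + 1) (cong₂ ℤ._+_ (sym (ℤ.*-identityʳ z)) (sym (ℤ.*-identityʳ w)))) ⟩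
  mkℚᵘ z 0 ℚᵘ.+ mkℚᵘ w 0           ≈⟨ ℚᵘ.+-cong (ℚ.toℚᵘ-fromℚᵘ (mkℚᵘ z 0)) (ℚ.toℚᵘ-fromℚᵘ (mkℚᵘ w 0)) ⟨
  toℚᵘ (z / 1) ℚᵘ.+ toℚᵘ (w / 1)   ≈⟨ ℚ.toℚᵘ-homo-+ (z / 1) (w / 1) ⟨
  toℚᵘ (z / 1 ℚ.+ w / 1)           ∎)
  where open ≈-Reasoning ℚᵘ.≃-setoid

/1-homo-∣∣ : ∀ z → ∣ z / 1 ∣ ≡ + ℤ.∣ z ∣ / 1
/1-homo-∣∣ z = ℚ.toℚᵘ-injective (begin
  toℚᵘ ∣ z / 1 ∣                   ≈⟨ ℚ.toℚᵘ-homo-∣-∣ (z / 1) ⟩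
  ℚᵘ.∣ toℚᵘ (z / 1) ∣              ≈⟨ ℚᵘ.∣-∣-cong (ℚ.toℚᵘ-fromℚᵘ (mkℚᵘ z 0)) ⟩
  mkℚᵘ (+ ℤ.∣ z ∣) 0               ≈⟨ ℚ.toℚᵘ-fromℚᵘ (mkℚᵘ (+ ℤ.∣ z ∣) 0) ⟨
  toℚᵘ (+ ℤ.∣ z ∣ / 1)             ∎)
  where open ≈-Reasoning ℚᵘ.≃-setoid

/1-injective : ∀ {z w} → z / 1 ≡ w / 1 → z ≡ w
/1-injective {z} {w} eq with *≡* z*1≡w*1 ← ℚ.fromℚᵘ-injective {mkℚᵘ z 0} {mkℚᵘ w 0} eq =
  trans (sym (ℤ.*-identityʳ z)) (trans z*1≡w*1 (ℤ.*-identityʳ w))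

fromℤ-+ : ∀ z w → fromℤ (z ℤ.+ w) ≃ fromℤ z +ᴿ fromℤ w
fromℤ-+ z w = pointwise λ _ → /1-homo-+ z w

fromℤ-∣∣ : ∀ z → ∣ fromℤ z ∣ᴿ ≃ fromℤ (+ ℤ.∣ z ∣)
fromℤ-∣∣ z = pointwise λ _ → /1-homo-∣∣ z

fromℤ-injective : ∀ {z w} → fromℤ z ≃ fromℤ w → z ≡ w
fromℤ-injective = /1-injective ∘ fromℚ-injective

fromℤ-× : ∀ k z → k ×ᴿ fromℤ z ≃ fromℤ (+ k ℤ.* z)
fromℤ-× zero    z = ≃-refl
fromℤ-× (suc k) z = ≃-trans (+-cong ≃-refl (fromℤ-× k z))
  (≃-trans (≃-sym (fromℤ-+ z (+ k ℤ.* z))) (pointwise λ _ → cong (_/ 1) (sym (ℤ.suc-* (+ k) z))))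

k×x≃k*x : ∀ k x → k ×ᴿ x ≃ fromℤ (+ k) *ᴿ x
k×x≃k*x k x = begin
  k ×ᴿ x             ≈⟨ ×-congʳ k (pointwise λ n → sym (ℚ.*-identityˡ (seq x n))) ⟩
  k ×ᴿ (1ℝ *ᴿ x)     ≈⟨ ×-assoc-* k 1ℝ x ⟨
  (k ×ᴿ 1ℝ) *ᴿ x     ≈⟨ *-cong (≃-trans (fromℤ-× k (+ 1)) (pointwise λ _ → cong (_/ 1) (ℤ.*-identityʳ (+ k)))) ≃-refl ⟩
  fromℤ (+ k) *ᴿ x   ∎
  where open ≈-Reasoning ≃-setoid

-- Bases of eigenspaces from pivot coordinates

sum-0 : ∀ {n} {f : Fin n → ℝ} → (∀ i → f i ≃ 0ℝ) → sumᴿ f ≃ 0ℝ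
sum-0 {n} f≃0 = ≃-trans (sum-cong-≋ f≃0) (sum-replicate-zero n)

δ : ∀ {n} → Fin n → Fin n → ℝ
δ i j = if does (i ≟ j) then 1ℝ else 0ℝ

δ-≡ : ∀ {n} {i j : Fin n} → i ≡ j → δ i j ≡ 1ℝ
δ-≡ {i = i} {j} i≡j = cong (if_then 1ℝ else 0ℝ) (dec-true (i ≟ j) i≡j)

δ-≢ : ∀ {n} {i j : Fin n} → i ≢ j → δ i j ≡ 0ℝ
δ-≢ {i = i} {j} i≢j = cong (if_then 1ℝ else 0ℝ) (dec-false (i ≟ j) i≢j)

x≃0⇒x*y≃0 : ∀ {x} y → x ≃ 0ℝ → x *ᴿ y ≃ 0ℝ
x≃0⇒x*y≃0 y x≃0 = ≃-trans (*-cong x≃0 ≃-refl) (pointwise λ n → ℚ.*-zeroˡ (seq y n))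

sum-δ : ∀ {n} (i : Fin n) (f : Fin n → ℝ) → sumᴿ (λ j → δ i j *ᴿ f j) ≃ f i
sum-δ zero f = ≃-trans (+-cong (≃-refl {1ℝ *ᴿ f zero}) (sum-0 {f = λ j → 0ℝ *ᴿ f (suc j)} λ j → x≃0⇒x*y≃0 (f (suc j)) ≃-refl))
  (pointwise λ n → solve 1 (λ x → con 1ℚ :* x :+ con 0ℚ := x) refl (seq (f zero) n))
  where open +-*-Solver
sum-δ (suc i) f = ≃-trans (+-cong (x≃0⇒x*y≃0 {0ℝ} (f zero) ≃-refl) (sum-δ i (f ∘ suc)))
  (pointwise λ n → ℚ.+-identityˡ (seq (f (suc i)) n))

δ-sym : ∀ {n} (i j : Fin n) → δ i j ≡ δ j i
δ-sym i j with i ≟ j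
... | yes i≡j = sym (δ-≡ (sym i≡j))
... | no  i≢j = sym (δ-≢ (i≢j ∘ sym))

x*yz≃y*xz : ∀ x y z → x *ᴿ (y *ᴿ z) ≃ y *ᴿ (x *ᴿ z)
x*yz≃y*xz x y z = pointwise λ n →
  solve 3 (λ x y z → x :* (y :* z) := y :* (x :* z)) refl (seq x n) (seq y n) (seq z n)
  where open +-*-Solver

eigenspace-combination : ∀ {n k} (A : Matrix n) μ (c : Vector ℝ k) (b : Fin k → Vector ℝ n) →
  (∀ j → Eigenspace A μ (b j)) → Eigenspace A μ (combination c b)
eigenspace-combination A μ c b eigen i = begin
  sumᴿ (λ k → A i k *ᴿ sumᴿ (λ j → c j *ᴿ b j k))     ≈⟨ sum-cong-≋ (λ k → *-distribˡ-sum (A i k) (λ j → c j *ᴿ b j k)) ⟩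
  sumᴿ (λ k → sumᴿ (λ j → A i k *ᴿ (c j *ᴿ b j k)))   ≈⟨ ∑-comm (λ k j → A i k *ᴿ (c j *ᴿ b j k)) ⟩
  sumᴿ (λ j → sumᴿ (λ k → A i k *ᴿ (c j *ᴿ b j k)))   ≈⟨ sum-cong-≋ (λ j → sum-cong-≋ (λ k → x*yz≃y*xz (A i k) (c j) (b j k))) ⟩
  sumᴿ (λ j → sumᴿ (λ k → c j *ᴿ (A i k *ᴿ b j k)))   ≈⟨ sum-cong-≋ (λ j → *-distribˡ-sum (c j) (λ k → A i k *ᴿ b j k)) ⟨
  sumᴿ (λ j → c j *ᴿ (A ·ᴹ b j) i)                    ≈⟨ sum-cong-≋ (λ j → *-cong (≃-refl {c j}) (eigen j i)) ⟩
  sumᴿ (λ j → c j *ᴿ (μ *ᴿ b j i))                    ≈⟨ sum-cong-≋ (λ j → x*yz≃y*xz (c j) μ (b j i)) ⟩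
  sumᴿ (λ j → μ *ᴿ (c j *ᴿ b j i))                    ≈⟨ *-distribˡ-sum μ (λ j → c j *ᴿ b j i) ⟨
  μ *ᴿ combination c b i                              ∎
  where open ≈-Reasoning ≃-setoid

-- Subtracting the combination with coefficients v (pivot l) leaves an eigenvector vanishing at all pivots.
pivots⇒hasDimension : ∀ {n k} (A : Matrix n) μ (b : Fin k → Vector ℝ n) (pivot : Fin k → Fin n) →
  (∀ j → Eigenspace A μ (b j)) →
  (∀ j l → b j (pivot l) ≃ δ j l) →
  (∀ v → Eigenspace A μ v → (∀ l → v (pivot l) ≃ 0ℝ) → v ≃ⱽ 0ⱽ) →
  HasDimension (Eigenspace A μ) k
pivots⇒hasDimension {n} {k} A μ b pivot eigen standard determined = record
  { basis       = b
  ; inside      = eigen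
  ; independent = λ c c·b≃0 j → ≃-trans (≃-sym (at-pivot c j)) (c·b≃0 (pivot j))
  ; spanning    = λ v v-eigen → v ∘ pivot , spans v v-eigen
  }
  where
  open +-*-Solver

  δ-flip : ∀ x j l → x *ᴿ δ j l ≃ δ l j *ᴿ x
  δ-flip x j l = pointwise λ n → trans (ℚ.*-comm (seq x n) (seq (δ j l) n)) (cong (λ d → seq d n ℚ.* seq x n) (δ-sym j l))

  -- Evaluation at the pivots reads off the coefficients; this gives independence and also dictates
  -- the coefficients for spanning.
  at-pivot : ∀ c l → combination c b (pivot l) ≃ c l
  at-pivot c l = ≃-trans
    (sum-cong-≋ λ j → ≃-trans (*-cong (≃-refl {c j}) (standard j l)) (δ-flip (c j) j l))
    (sum-δ l c)

  spans : ∀ v → Eigenspace A μ v → v ≃ⱽ combination (v ∘ pivot) b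
  spans v v-eigen i = ≃-trans (≃-trans (split (v i) (w i)) (+-cong (determined v-w v-w-eigen vanishes i) ≃-refl))
                              (pointwise λ n → ℚ.+-identityˡ (seq (w i) n))
    where
    w = combination (v ∘ pivot) b
    -- The difference v - w is written as a combination of two vectors so that
    -- `eigenspace-combination` applies to it.
    sign : Fin 2 → ℝ
    sign zero       = 1ℝ
    sign (suc zero) = -ᴿ 1ℝ
    pair : Fin 2 → Vector ℝ n
    pair zero       = v
    pair (suc zero) = w
    v-w = combination sign pair

    v-w-eigen : Eigenspace A μ v-w
    v-w-eigen = eigenspace-combination A μ sign pair λ
      { zero → v-eigen ; (suc zero) → eigenspace-combination A μ (v ∘ pivot) b eigen }

    split : ∀ x y → x ≃ (1ℝ *ᴿ x +ᴿ (-ᴿ 1ℝ *ᴿ y +ᴿ 0ℝ)) +ᴿ y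
    split x y = pointwise λ n →
      solve 2 (λ x y → x := (con 1ℚ :* x :+ (con (ℚ.- 1ℚ) :* con 1ℚ :* y :+ con 0ℚ)) :+ y) refl (seq x n) (seq y n)

    vanishes : ∀ l → v-w (pivot l) ≃ 0ℝ
    vanishes l = ≃-trans
      (+-cong (≃-refl {1ℝ *ᴿ v (pivot l)}) (+-cong (*-cong (≃-refl { -ᴿ 1ℝ}) (at-pivot (v ∘ pivot) l)) (≃-refl {0ℝ})))
      (pointwise λ n → solve 1 (λ x → con 1ℚ :* x :+ (con (ℚ.- 1ℚ) :* con 1ℚ :* x :+ con 0ℚ) := con 0ℚ) refl
        (seq (v (pivot l)) n))

1≄0 : ¬ 1ℝ ≃ 0ℝ
1≄0 1≃0 with () ← fromℚ-injective 1≃0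

-- If the first basis vector were zero, the combination with coefficients `δ zero` would vanish
-- although one coefficient is 1.
hasDimension⇒isEigenvalue : ∀ {n k} {A : Matrix n} {μ} → HasDimension (Eigenspace A μ) (suc k) → IsEigenvalue A μ
hasDimension⇒isEigenvalue dim = basis zero , nonzero , inside zero
  where
  open HasDimension dim
  nonzero : ¬ basis zero ≃ⱽ 0ⱽ
  nonzero b₀≃0 = 1≄0 (independent (δ zero)
    (λ i → ≃-trans (sum-δ zero (λ j → basis j i)) (b₀≃0 i)) zero)

sum-combine : ∀ m n (f : Fin (m ℕ.* n) → ℝ) → sumᴿ f ≃ sumᴿ λ i → sumᴿ λ j → f (combine {m} i j)
sum-combine zero    n f = ≃-refl
sum-combine (suc m) n f = ≃-trans (sum-++ n f)
  (+-cong (≃-refl {sumᴿ λ j → f (j ↑ˡ (m ℕ.* n))}) (sum-combine m n (f ∘ (n ↑ʳ_))))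
  where
  sum-++ : ∀ k {l} (f : Fin (k ℕ.+ l) → ℝ) → sumᴿ f ≃ sumᴿ (λ i → f (i ↑ˡ l)) +ᴿ sumᴿ (λ i → f (k ↑ʳ i))
  sum-++ zero    f = pointwise λ n → sym (ℚ.+-identityˡ (seq (sumᴿ f) n))
  sum-++ (suc k) f = ≃-trans (+-cong (≃-refl {f zero}) (sum-++ k (f ∘ suc)))
    (pointwise λ n → sym (ℚ.+-assoc (seq (f zero) n) _ _))

-- The spectrum of the rook's graph

≃-reflexive : ∀ {x y} → x ≡ y → x ≃ y
≃-reflexive refl = ≃-refl

fromℕ : ℕ → ℝ
fromℕ k = fromℤ (+ k)

sum-const : ∀ k x → sumᴿ {k} (λ _ → x) ≃ fromℕ k *ᴿ x
sum-const k x = ≃-trans (sum-replicate k) (k×x≃k*x k x)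

-- Extends vanishing from the indices `suc i`, where the pivots lie, to the index `zero` when the
-- sum is known to be zero.
head≃0 : ∀ {k} (f : Fin (suc k) → ℝ) → sumᴿ f ≃ 0ℝ → (∀ i → f (suc i) ≃ 0ℝ) → f zero ≃ 0ℝ
head≃0 f Σ≃0 tail≃0 = begin
  f zero                       ≈⟨ pointwise (λ n → ℚ.+-identityʳ (seq (f zero) n)) ⟨
  f zero +ᴿ 0ℝ                 ≈⟨ +-cong (≃-refl {f zero}) (sum-0 tail≃0) ⟨
  sumᴿ f                       ≈⟨ Σ≃0 ⟩
  0ℝ                           ∎
  where open ≈-Reasoning ≃-setoid

rowSum : ∀ {a b} → (Fin a → Fin b → ℝ) → Fin a → ℝ
rowSum V i = sumᴿ (V i)

colSum : ∀ {a b} → (Fin a → Fin b → ℝ) → Fin b → ℝ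
colSum V = rowSum (flip V)

-- The eigenvalue equation of the rook's graph K_a □ K_b: a row sum and a column sum both contain
-- the entry itself, so ν stands for μ + 2.
IsTable : ∀ {a b} → ℝ → (Fin a → Fin b → ℝ) → Set
IsTable ν V = ∀ i j → ν *ᴿ V i j ≃ rowSum V i +ᴿ colSum V j

module Table {a b} {ν} (V : Fin a → Fin b → ℝ) (table : IsTable ν V) where
  open ≈-Reasoning ≃-setoid

  total : ℝ
  total = sumᴿ (colSum V)

  rowSum-eq : ∀ i → ν *ᴿ rowSum V i ≃ fromℕ b *ᴿ rowSum V i +ᴿ total
  rowSum-eq i = begin
    ν *ᴿ rowSum V i                            ≈⟨ *-distribˡ-sum ν (V i) ⟩
    sumᴿ (λ j → ν *ᴿ V i j)                    ≈⟨ sum-cong-≋ (table i) ⟩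
    sumᴿ (λ j → rowSum V i +ᴿ colSum V j)      ≈⟨ ∑-distrib-+ (λ _ → rowSum V i) (colSum V) ⟩
    sumᴿ {b} (λ _ → rowSum V i) +ᴿ total       ≈⟨ +-cong (sum-const b (rowSum V i)) ≃-refl ⟩
    fromℕ b *ᴿ rowSum V i +ᴿ total             ∎

  sum-rowSum : sumᴿ (rowSum V) ≃ total
  sum-rowSum = ∑-comm V

  total-eq : ν *ᴿ total ≃ fromℕ (a ℕ.+ b) *ᴿ total
  total-eq = begin
    ν *ᴿ total                                              ≈⟨ *-cong (≃-refl {ν}) sum-rowSum ⟨
    ν *ᴿ sumᴿ (rowSum V)                                    ≈⟨ *-distribˡ-sum ν (rowSum V) ⟩
    sumᴿ (λ i → ν *ᴿ rowSum V i)                            ≈⟨ sum-cong-≋ rowSum-eq ⟩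
    sumᴿ (λ i → fromℕ b *ᴿ rowSum V i +ᴿ total)             ≈⟨ ∑-distrib-+ (λ i → fromℕ b *ᴿ rowSum V i) (λ _ → total) ⟩
    sumᴿ (λ i → fromℕ b *ᴿ rowSum V i) +ᴿ sumᴿ {a} (λ _ → total)
      ≈⟨ +-cong (*-distribˡ-sum (fromℕ b) (rowSum V)) (≃-sym (sum-const a total)) ⟨
    fromℕ b *ᴿ sumᴿ (rowSum V) +ᴿ fromℕ a *ᴿ total          ≈⟨ +-cong (*-cong (≃-refl {fromℕ b}) sum-rowSum) ≃-refl ⟩
    fromℕ b *ᴿ total +ᴿ fromℕ a *ᴿ total
      ≈⟨ pointwise (λ n → solve 3 (λ b t a → b :* t :+ a :* t := (a :+ b) :* t) refl
           (seq (fromℕ b) n) (seq total n) (seq (fromℕ a) n)) ⟩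
    (fromℕ a +ᴿ fromℕ b) *ᴿ total                           ≈⟨ *-cong (fromℤ-+ (+ a) (+ b)) ≃-refl ⟨
    fromℕ (a ℕ.+ b) *ᴿ total                                ∎
    where open +-*-Solver

  total≃0 : ¬ ν ≃ fromℕ (a ℕ.+ b) → total ≃ 0ℝ
  total≃0 ν≄a+b = x*z≃y*z⇒z≃0 ν≄a+b total-eq

  rowSum≃0 : total ≃ 0ℝ → ¬ ν ≃ fromℕ b → ∀ i → rowSum V i ≃ 0ℝ
  rowSum≃0 total≃0 ν≄b i = x*z≃y*z⇒z≃0 ν≄b $ begin
    ν *ᴿ rowSum V i                     ≈⟨ rowSum-eq i ⟩
    fromℕ b *ᴿ rowSum V i +ᴿ total      ≈⟨ +-cong ≃-refl total≃0 ⟩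
    fromℕ b *ᴿ rowSum V i +ᴿ 0ℝ         ≈⟨ pointwise (λ n → ℚ.+-identityʳ (seq (fromℕ b *ᴿ rowSum V i) n)) ⟩
    fromℕ b *ᴿ rowSum V i               ∎

  -- Subtracting two instances of `rowSum-eq` cancels the total, so this also covers ν = a + b,
  -- where the total need not vanish.
  rowSum-const : ¬ ν ≃ fromℕ b → ∀ i k → rowSum V i ≃ rowSum V k
  rowSum-const ν≄b i k = x-y≃0⇒x≃y $ x*z≃y*z⇒z≃0 ν≄b $ begin
    ν *ᴿ (x +ᴿ -ᴿ y)                       ≈⟨ distrib ν ⟩
    ν *ᴿ x +ᴿ -ᴿ (ν *ᴿ y)                  ≈⟨ +-cong (rowSum-eq i) (*-cong (≃-refl {fromℚ (ℚ.- 1ℚ)}) (rowSum-eq k)) ⟩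
    (fromℕ b *ᴿ x +ᴿ total) +ᴿ -ᴿ (fromℕ b *ᴿ y +ᴿ total)
      ≈⟨ pointwise (λ n → solve 4 (λ b x y t → (b :* x :+ t) :+ con (ℚ.- 1ℚ) :* (b :* y :+ t) := b :* (x :+ con (ℚ.- 1ℚ) :* y))
           refl
           (seq (fromℕ b) n) (seq x n) (seq y n) (seq total n)) ⟩
    fromℕ b *ᴿ (x +ᴿ -ᴿ y)                 ∎
    where
    open +-*-Solver
    x = rowSum V i
    y = rowSum V k
    distrib : ∀ z → z *ᴿ (x +ᴿ -ᴿ y) ≃ z *ᴿ x +ᴿ -ᴿ (z *ᴿ y)
    distrib z = pointwise λ n → solve 3 (λ z x y → z :* (x :+ con (ℚ.- 1ℚ) :* y) := z :* x :+ con (ℚ.- 1ℚ) :* (z :* y)) refl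
      (seq z n) (seq x n) (seq y n)

  entry≃0 : (∀ i → rowSum V i ≃ 0ℝ) → (∀ j → colSum V j ≃ 0ℝ) → ¬ ν ≃ 0ℝ → ∀ i j → V i j ≃ 0ℝ
  entry≃0 row≃0 col≃0 ν≄0 i j = x*y≃0⇒y≃0 ν≄0 $ begin
    ν *ᴿ V i j                    ≈⟨ table i j ⟩
    rowSum V i +ᴿ colSum V j      ≈⟨ +-cong (row≃0 i) (col≃0 j) ⟩
    0ℝ +ᴿ 0ℝ                      ≈⟨ pointwise (λ _ → ℚ.+-identityˡ 0ℚ) ⟩
    0ℝ                            ∎

  -- Makes every statement on rows available for columns. The total of the flipped table is the sum
  -- of the row sums, which is why `sum-rowSum` accompanies its uses.
  flipped : IsTable ν (flip V)
  flipped j i = begin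
    ν *ᴿ V i j                    ≈⟨ table i j ⟩
    rowSum V i +ᴿ colSum V j      ≈⟨ pointwise (λ n → ℚ.+-comm (seq (rowSum V i) n) (seq (colSum V j) n)) ⟩
    colSum V j +ᴿ rowSum V i      ∎

record Grid (N a b : ℕ) : Set where
  field
    at         : Fin a → Fin b → Fin N
    row        : Fin N → Fin a
    col        : Fin N → Fin b
    at-row-col : ∀ u → at (row u) (col u) ≡ u
    row-at     : ∀ i j → row (at i j) ≡ i
    col-at     : ∀ i j → col (at i j) ≡ j

  flatten : Permutation (a ℕ.* b) N
  flatten = permutation
    (λ k → uncurry at (remQuot b k)) (λ u → combine (row u) (col u))
    (λ u → trans (cong (uncurry at) (remQuot-combine (row u) (col u))) (at-row-col u))
    (λ k → trans (cong₂ combine (row-at _ _) (col-at _ _)) (combine-remQuot {a} b k))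

  sum-grid : ∀ f → sumᴿ f ≃ sumᴿ λ i → sumᴿ λ j → f (at i j)
  sum-grid f = begin
    sumᴿ f                                            ≈⟨ sum-permute f flatten ⟩
    sumᴿ (λ k → f (uncurry at (remQuot b k)))         ≈⟨ sum-combine a b (λ k → f (uncurry at (remQuot b k))) ⟩
    sumᴿ (λ i → sumᴿ λ j → f (uncurry at (remQuot b (combine {a} i j))))
      ≈⟨ sum-cong-≋ (λ i → sum-cong-≋ λ j → ≃-reflexive (cong (f ∘ uncurry at) (remQuot-combine i j))) ⟩
    sumᴿ (λ i → sumᴿ λ j → f (at i j))                ∎
    where open ≈-Reasoning ≃-setoid

-- Encodes `A` by the action of A + 2I instead of by its entries: this is what the eigenvector
-- analysis consumes, and it is symmetric in rows and columns.
record IsRook {N} (A : Matrix N) (a b : ℕ) : Set where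
  field
    grid : Grid N a b
  open Grid grid public
  field
    action : ∀ v i j → fromℕ 2 *ᴿ v (at i j) +ᴿ (A ·ᴹ v) (at i j) ≃
                       rowSum (λ k l → v (at k l)) i +ᴿ colSum (λ k l → v (at k l)) j

transpose : ∀ {N} {A : Matrix N} {a b} → IsRook A a b → IsRook A b a
transpose {A = A} rook = record
  { grid = record
    { at         = flip at
    ; row        = col
    ; col        = row
    ; at-row-col = at-row-col
    ; row-at     = flip col-at
    ; col-at     = flip row-at
    }
  ; action = λ v j i → ≃-trans (action v i j)
      (pointwise λ n → ℚ.+-comm (seq (rowSum (λ k l → v (at k l)) i) n) (seq (colSum (λ k l → v (at k l)) j) n))
  }
  where open IsRook rook

fromℕ-≄ : ∀ {k l} → k ≢ l → ¬ fromℕ k ≃ fromℕ l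
fromℕ-≄ k≢l = k≢l ∘ ℤ.+-injective ∘ fromℤ-injective

-- Tying `ν` to 2 + μ only up to `_≃_` lets it be a literal such as `fromℕ b` when bases are built,
-- and 2 + μ itself when μ is unknown.
module Eigenspaces {N} {A : Matrix N} {a b} (rook : IsRook A a b) {μ ν} (ν≃2+μ : ν ≃ fromℕ 2 +ᴿ μ) where
  open IsRook rook
  open ≈-Reasoning ≃-setoid

  pull : (Fin a → Fin b → ℝ) → Vector ℝ N
  pull f u = f (row u) (col u)

  pull-at : ∀ f i j → pull f (at i j) ≡ f i j
  pull-at f i j = cong₂ f (row-at i j) (col-at i j)

  ν*x : ∀ x → ν *ᴿ x ≃ fromℕ 2 *ᴿ x +ᴿ μ *ᴿ x
  ν*x x = ≃-trans (*-cong ν≃2+μ (≃-refl {x}))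
    (pointwise λ n → ℚ.*-distribʳ-+ (seq x n) (seq (fromℕ 2) n) (seq μ n))

  eigenvector⇒table : ∀ v → Eigenspace A μ v → IsTable ν (λ i j → v (at i j))
  eigenvector⇒table v eigen i j = begin
    ν *ᴿ v (at i j)                                   ≈⟨ ν*x (v (at i j)) ⟩
    fromℕ 2 *ᴿ v (at i j) +ᴿ μ *ᴿ v (at i j)          ≈⟨ +-cong (≃-refl {fromℕ 2 *ᴿ v (at i j)}) (eigen (at i j)) ⟨
    fromℕ 2 *ᴿ v (at i j) +ᴿ (A ·ᴹ v) (at i j)        ≈⟨ action v i j ⟩
    rowSum (λ k l → v (at k l)) i +ᴿ colSum (λ k l → v (at k l)) j ∎

  table⇒eigenvector : ∀ f → IsTable ν f → Eigenspace A μ (pull f)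
  table⇒eigenvector f table u = subst (λ u → (A ·ᴹ v) u ≃ μ *ᴿ v u) (at-row-col u)
    (+-cancelˡ (fromℕ 2 *ᴿ v (at i j)) _ _ $ begin
      fromℕ 2 *ᴿ v (at i j) +ᴿ (A ·ᴹ v) (at i j)        ≈⟨ action v i j ⟩
      rowSum (λ k l → v (at k l)) i +ᴿ colSum (λ k l → v (at k l)) j
        ≈⟨ +-cong (sum-cong-≋ (λ l → ≃-reflexive (pull-at f i l))) (sum-cong-≋ (λ k → ≃-reflexive (pull-at f k j))) ⟩
      rowSum f i +ᴿ colSum f j                          ≈⟨ table i j ⟨
      ν *ᴿ f i j                                        ≡⟨ cong (ν *ᴿ_) (pull-at f i j) ⟨
      ν *ᴿ v (at i j)                                   ≈⟨ ν*x (v (at i j)) ⟩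
      fromℕ 2 *ᴿ v (at i j) +ᴿ μ *ᴿ v (at i j)          ∎)
    where
    v = pull f
    i = row u
    j = col u

  entries≃0⇒≃0 : ∀ v → (∀ i j → v (at i j) ≃ 0ℝ) → v ≃ⱽ 0ⱽ
  entries≃0⇒≃0 v v-at≃0 u = subst (λ u → v u ≃ 0ℝ) (at-row-col u) (v-at≃0 (row u) (col u))

-- Explicit bases of the four eigenspaces.

difference : ∀ {m} → Fin m → Fin (suc m) → ℝ
difference s zero    = fromℚ (ℚ.- 1ℚ)
difference s (suc i) = δ s i

-- The vector `difference s` is e_(s+1) - e_0. These span the vectors of sum zero, and away from
-- index 0 they restrict to `δ`, as pivots require.
sum-difference : ∀ {m} (s : Fin m) → sumᴿ (difference s) ≃ 0ℝ
sum-difference s = begin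
  fromℚ (ℚ.- 1ℚ) +ᴿ sumᴿ (δ s)
    ≈⟨ +-cong (≃-refl {fromℚ (ℚ.- 1ℚ)}) (sum-cong-≋ λ i → pointwise λ n → ℚ.*-identityʳ (seq (δ s i) n)) ⟨
  fromℚ (ℚ.- 1ℚ) +ᴿ sumᴿ (λ i → δ s i *ᴿ 1ℝ)  ≈⟨ +-cong ≃-refl (sum-δ s (λ _ → 1ℝ)) ⟩
  fromℚ (ℚ.- 1ℚ) +ᴿ 1ℝ                        ≈⟨ pointwise (λ _ → ℚ.+-inverseˡ 1ℚ) ⟩
  0ℝ                                          ∎
  where open ≈-Reasoning ≃-setoid

module _ {N} {A : Matrix N} {m n} (rook : IsRook A (suc m) (suc n)) where
  open IsRook rook
  open ≈-Reasoning ≃-setoid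

  private
    a = suc m
    b = suc n

  -- For ν = a + b, which differs from both a and b, all row sums agree and all column sums agree.
  -- Hence ν V i j does not depend on the cell, and one pivot determines the vector.
  constant-dimension : ∀ {μ} → fromℕ (a ℕ.+ b) ≃ fromℕ 2 +ᴿ μ → HasDimension (Eigenspace A μ) 1
  constant-dimension {μ} ν≃2+μ = pivots⇒hasDimension A μ (λ _ → pull ones) (λ _ → at zero zero)
    (λ _ → table⇒eigenvector ones table) (λ { zero zero → ≃-refl }) determined
    where
    open Eigenspaces rook {ν = fromℕ (a ℕ.+ b)} ν≃2+μ

    ones : Fin a → Fin b → ℝ
    ones _ _ = 1ℝ

    table : IsTable (fromℕ (a ℕ.+ b)) ones
    table i j = begin
      fromℕ (a ℕ.+ b) *ᴿ 1ℝ                       ≈⟨ *-cong (fromℤ-+ (+ a) (+ b)) (≃-refl {1ℝ}) ⟩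
      (fromℕ a +ᴿ fromℕ b) *ᴿ 1ℝ
        ≈⟨ pointwise (λ n → solve 2 (λ a b → (a :+ b) :* con 1ℚ := b :* con 1ℚ :+ a :* con 1ℚ) refl
             (seq (fromℕ a) n) (seq (fromℕ b) n)) ⟩
      fromℕ b *ᴿ 1ℝ +ᴿ fromℕ a *ᴿ 1ℝ              ≈⟨ +-cong (sum-const b 1ℝ) (sum-const a 1ℝ) ⟨
      rowSum ones i +ᴿ colSum ones j              ∎
      where open +-*-Solver

    determined : ∀ v → Eigenspace A μ v → (Fin 1 → v (at zero zero) ≃ 0ℝ) → v ≃ⱽ 0ⱽ
    determined v eigen v₀₀≃0 = entries≃0⇒≃0 v λ i j → x*y≃0⇒y≃0 {fromℕ (a ℕ.+ b)} {v (at i j)} a+b≄0 $ begin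
      fromℕ (a ℕ.+ b) *ᴿ v (at i j)          ≈⟨ vt i j ⟩
      rowSum V i +ᴿ colSum V j               ≈⟨ +-cong (T.rowSum-const a+b≄b i zero) (Tᵀ.rowSum-const a+b≄a j zero) ⟩
      rowSum V zero +ᴿ colSum V zero         ≈⟨ vt zero zero ⟨
      fromℕ (a ℕ.+ b) *ᴿ v (at zero zero)    ≈⟨ *-cong (≃-refl {fromℕ (a ℕ.+ b)}) (v₀₀≃0 zero) ⟩
      fromℕ (a ℕ.+ b) *ᴿ 0ℝ                  ≈⟨ pointwise (λ n → ℚ.*-zeroʳ (seq (fromℕ (a ℕ.+ b)) n)) ⟩
      0ℝ                                     ∎
      where
      V : Fin a → Fin b → ℝ
      V i j = v (at i j)
      vt = eigenvector⇒table v eigen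
      module T = Table V vt
      module Tᵀ = Table (flip V) T.flipped
      a+b≄0 = fromℕ-≄ {a ℕ.+ b} {0} λ ()
      a+b≄b = fromℕ-≄ {a ℕ.+ b} {b} (ℕ.m≢1+n+m b ∘ sym)
      a+b≄a = fromℕ-≄ {a ℕ.+ b} {a} (ℕ.m+1+n≢m a)

  -- The pivots are the cells of column 0 outside row 0. With column sums zero, a zero pivot forces
  -- its row sum to vanish; the total then settles row 0, and the table equation gives all entries
  -- because b is nonzero.
  row-dimension : a ≢ b → ∀ {μ} → fromℕ b ≃ fromℕ 2 +ᴿ μ → HasDimension (Eigenspace A μ) m
  row-dimension a≢b {μ} ν≃2+μ = pivots⇒hasDimension A μ (pull ∘ f) (λ s → at (suc s) zero)
    (λ s → table⇒eigenvector (f s) (table s)) (λ s l → ≃-reflexive (pull-at (f s) (suc l) zero)) determined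
    where
    open Eigenspaces rook {ν = fromℕ b} ν≃2+μ

    f : Fin m → Fin a → Fin b → ℝ
    f s i _ = difference s i

    table : ∀ s → IsTable (fromℕ b) (f s)
    table s i j = begin
      fromℕ b *ᴿ difference s i             ≈⟨ sum-const b (difference s i) ⟨
      rowSum (f s) i                        ≈⟨ pointwise (λ n → ℚ.+-identityʳ (seq (rowSum (f s) i) n)) ⟨
      rowSum (f s) i +ᴿ 0ℝ                  ≈⟨ +-cong (≃-refl {rowSum (f s) i}) (sum-difference s) ⟨
      rowSum (f s) i +ᴿ colSum (f s) j      ∎

    determined : ∀ v → Eigenspace A μ v → (∀ s → v (at (suc s) zero) ≃ 0ℝ) → v ≃ⱽ 0ⱽ
    determined v eigen pivots≃0 = entries≃0⇒≃0 v
      (T.entry≃0 row≃0 col≃0 (fromℕ-≄ {b} {0} λ ()))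
      where
      V : Fin a → Fin b → ℝ
      V i j = v (at i j)
      vt = eigenvector⇒table v eigen
      module T = Table V vt
      module Tᵀ = Table (flip V) T.flipped
      b≄a+b = fromℕ-≄ {b} {a ℕ.+ b} (ℕ.m≢1+n+m b)
      total≃0 = ≃-trans T.sum-rowSum (T.total≃0 b≄a+b)
      -- Here `a ≢ b` enters: on a square board the eigenspaces for rows and columns coincide, and
      -- nonzero column sums could survive.
      col≃0 = Tᵀ.rowSum≃0 total≃0 (fromℕ-≄ {b} {a} (a≢b ∘ sym))
      row-suc≃0 : ∀ s → rowSum V (suc s) ≃ 0ℝ
      row-suc≃0 s = begin
        rowSum V (suc s)                        ≈⟨ pointwise (λ n → ℚ.+-identityʳ (seq (rowSum V (suc s)) n)) ⟨
        rowSum V (suc s) +ᴿ 0ℝ                  ≈⟨ +-cong (≃-refl {rowSum V (suc s)}) (col≃0 zero) ⟨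
        rowSum V (suc s) +ᴿ colSum V zero       ≈⟨ vt (suc s) zero ⟨
        fromℕ b *ᴿ V (suc s) zero               ≈⟨ *-cong (≃-refl {fromℕ b}) (pivots≃0 s) ⟩
        fromℕ b *ᴿ 0ℝ                           ≈⟨ pointwise (λ n → ℚ.*-zeroʳ (seq (fromℕ b) n)) ⟩
        0ℝ                                      ∎
      row≃0 : ∀ i → rowSum V i ≃ 0ℝ
      row≃0 zero    = head≃0 (rowSum V) total≃0 row-suc≃0
      row≃0 (suc s) = row-suc≃0 s

  -- The basis consists of the products of a row difference and a column difference. The pivots are
  -- the cells outside row 0 and column 0; zero sums first recover column 0 and then row 0.
  doublyBalanced-dimension : ∀ {μ} → fromℕ 0 ≃ fromℕ 2 +ᴿ μ → HasDimension (Eigenspace A μ) (m ℕ.* n)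
  doublyBalanced-dimension {μ} ν≃2+μ = pivots⇒hasDimension A μ (pull ∘ f) pivot
    (λ k → table⇒eigenvector (f k) (table k)) standard determined
    where
    open Eigenspaces rook {ν = fromℕ 0} ν≃2+μ

    s : Fin (m ℕ.* n) → Fin m
    s k = proj₁ (remQuot n k)
    t : Fin (m ℕ.* n) → Fin n
    t k = proj₂ (remQuot {m} n k)

    f : Fin (m ℕ.* n) → Fin a → Fin b → ℝ
    f k i j = difference (s k) i *ᴿ difference (t k) j

    pivot : Fin (m ℕ.* n) → Fin N
    pivot l = at (suc (s l)) (suc (t l))

    row≃0 : ∀ k i → rowSum (f k) i ≃ 0ℝ
    row≃0 k i = begin
      sumᴿ (λ j → difference (s k) i *ᴿ difference (t k) j)  ≈⟨ *-distribˡ-sum (difference (s k) i) (difference (t k)) ⟨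
      difference (s k) i *ᴿ sumᴿ (difference (t k))          ≈⟨ *-cong (≃-refl {difference (s k) i}) (sum-difference (t k)) ⟩
      difference (s k) i *ᴿ 0ℝ                               ≈⟨ pointwise (λ n → ℚ.*-zeroʳ (seq (difference (s k) i) n)) ⟩
      0ℝ                                                     ∎

    col≃0 : ∀ k j → colSum (f k) j ≃ 0ℝ
    col≃0 k j = begin
      sumᴿ (λ i → difference (s k) i *ᴿ difference (t k) j)  ≈⟨ *-distribʳ-sum (difference (t k) j) (difference (s k)) ⟨
      sumᴿ (difference (s k)) *ᴿ difference (t k) j          ≈⟨ x≃0⇒x*y≃0 (difference (t k) j) (sum-difference (s k)) ⟩
      0ℝ                                                     ∎

    table : ∀ k → IsTable (fromℕ 0) (f k)
    table k i j = begin
      fromℕ 0 *ᴿ f k i j                    ≈⟨ x≃0⇒x*y≃0 (f k i j) (≃-refl {fromℕ 0}) ⟩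
      0ℝ                                    ≈⟨ pointwise (λ _ → ℚ.+-identityˡ 0ℚ) ⟨
      0ℝ +ᴿ 0ℝ                              ≈⟨ +-cong (row≃0 k i) (col≃0 k j) ⟨
      rowSum (f k) i +ᴿ colSum (f k) j      ∎

    standard : ∀ k l → pull (f k) (pivot l) ≃ δ k l
    standard k l = ≃-trans (≃-reflexive (pull-at (f k) (suc (s l)) (suc (t l)))) (product (k ≟ l))
      where
      product : Dec (k ≡ l) → δ (s k) (s l) *ᴿ δ (t k) (t l) ≃ δ k l
      product (yes k≡l) = begin
        δ (s k) (s l) *ᴿ δ (t k) (t l)  ≡⟨ cong₂ _*ᴿ_ (δ-≡ (cong s k≡l)) (δ-≡ (cong t k≡l)) ⟩
        1ℝ *ᴿ 1ℝ                        ≈⟨ pointwise (λ _ → ℚ.*-identityˡ 1ℚ) ⟩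
        1ℝ                              ≡⟨ δ-≡ k≡l ⟨
        δ k l                           ∎
      product (no k≢l) with s k ≟ s l | t k ≟ t l
      -- Equal quotient and remainder would make the flat indices equal. In the other two cases the
      -- deltas in the goal have already reduced, one of them to `0ℝ`.
      ... | yes sk≡sl | yes tk≡tl = contradiction
        (trans (sym (combine-remQuot {m} n k)) (trans (cong₂ combine sk≡sl tk≡tl) (combine-remQuot {m} n l))) k≢l
      ... | no sk≢sl | _ = begin
        _     ≈⟨ x≃0⇒x*y≃0 _ ≃-refl ⟩
        0ℝ    ≡⟨ δ-≢ k≢l ⟨
        δ k l ∎
      ... | yes _ | no tk≢tl = begin
        _     ≈⟨ pointwise (λ _ → ℚ.*-zeroʳ 1ℚ) ⟩
        0ℝ    ≡⟨ δ-≢ k≢l ⟨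
        δ k l ∎

    determined : ∀ v → Eigenspace A μ v → (∀ l → v (pivot l) ≃ 0ℝ) → v ≃ⱽ 0ⱽ
    determined v eigen pivots≃0 = entries≃0⇒≃0 v V≃0
      where
      V : Fin a → Fin b → ℝ
      V i j = v (at i j)
      module T = Table V (eigenvector⇒table v eigen)
      module Tᵀ = Table (flip V) T.flipped
      total≃0 = T.total≃0 (fromℕ-≄ {0} {a ℕ.+ b} λ ())
      V-suc≃0 : ∀ i j → V (suc i) j ≃ 0ℝ
      V-suc-suc≃0 : ∀ i j → V (suc i) (suc j) ≃ 0ℝ
      V-suc-suc≃0 i j = subst (λ (i , j) → V (suc i) (suc j) ≃ 0ℝ) (remQuot-combine i j) (pivots≃0 (combine i j))
      V-suc≃0 i zero    = head≃0 (V (suc i)) (T.rowSum≃0 total≃0 (fromℕ-≄ {0} {b} λ ()) (suc i)) (V-suc-suc≃0 i)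
      V-suc≃0 i (suc j) = V-suc-suc≃0 i j
      V≃0 : ∀ i j → V i j ≃ 0ℝ
      V≃0 zero    j = head≃0 (flip V j)
        (Tᵀ.rowSum≃0 (≃-trans T.sum-rowSum total≃0) (fromℕ-≄ {0} {a} λ ()) j) (λ i → V-suc≃0 i j)
      V≃0 (suc i) j = V-suc≃0 i j

  -- Stated as a refutation because one of four equalities cannot be picked here: avoiding all four
  -- values kills the total, then the row and column sums, then every entry of an eigenvector.
  eigenvalue-cases : ∀ {μ ν} → ν ≃ fromℕ 2 +ᴿ μ → IsEigenvalue A μ →
    ¬ (¬ ν ≃ fromℕ (a ℕ.+ b) × ¬ ν ≃ fromℕ b × ¬ ν ≃ fromℕ a × ¬ ν ≃ fromℕ 0)
  eigenvalue-cases {ν = ν} ν≃2+μ (v , v≄0 , eigen) (ν≄a+b , ν≄b , ν≄a , ν≄0) = v≄0 (entries≃0⇒≃0 v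
    (T.entry≃0 (T.rowSum≃0 total≃0 ν≄b) (Tᵀ.rowSum≃0 (≃-trans T.sum-rowSum total≃0) ν≄a) ν≄0))
    where
    open Eigenspaces rook ν≃2+μ
    V : Fin a → Fin b → ℝ
    V i j = v (at i j)
    module T = Table {ν = ν} V (eigenvector⇒table v eigen)
    module Tᵀ = Table (flip V) T.flipped
    total≃0 = T.total≃0 ν≄a+b

-- Assembly of the spectrum and of its absolute sum.

sum-×-∣fromℤ∣ : ∀ {k} (c : Fin k → ℕ) (z : Fin k → ℤ) →
  sumᴿ (λ i → c i ×ᴿ ∣ fromℤ (z i) ∣ᴿ) ≃ fromℕ (sumᴺ λ i → c i ℕ.* ℤ.∣ z i ∣)
sum-×-∣fromℤ∣ {zero}  c z = ≃-refl
sum-×-∣fromℤ∣ {suc k} c z = begin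
  c zero ×ᴿ ∣ fromℤ (z zero) ∣ᴿ +ᴿ sumᴿ (λ i → c (suc i) ×ᴿ ∣ fromℤ (z (suc i)) ∣ᴿ)
    ≈⟨ +-cong term (sum-×-∣fromℤ∣ (c ∘ suc) (z ∘ suc)) ⟩
  fromℕ (c zero ℕ.* ℤ.∣ z zero ∣) +ᴿ fromℕ (sumᴺ λ i → c (suc i) ℕ.* ℤ.∣ z (suc i) ∣)
    ≈⟨ fromℤ-+ (+ (c zero ℕ.* ℤ.∣ z zero ∣)) (+ sumᴺ λ i → c (suc i) ℕ.* ℤ.∣ z (suc i) ∣) ⟨
  fromℕ (sumᴺ λ i → c i ℕ.* ℤ.∣ z i ∣) ∎
  where
  open ≈-Reasoning ≃-setoid
  term : c zero ×ᴿ ∣ fromℤ (z zero) ∣ᴿ ≃ fromℕ (c zero ℕ.* ℤ.∣ z zero ∣)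
  term = begin
    c zero ×ᴿ ∣ fromℤ (z zero) ∣ᴿ       ≈⟨ ×-congʳ (c zero) (fromℤ-∣∣ (z zero)) ⟩
    c zero ×ᴿ fromℕ ℤ.∣ z zero ∣        ≈⟨ fromℤ-× (c zero) (+ ℤ.∣ z zero ∣) ⟩
    fromℤ (+ c zero ℤ.* + ℤ.∣ z zero ∣) ≡⟨ cong fromℤ (ℤ.pos-* (c zero) ℤ.∣ z zero ∣) ⟨
    fromℕ (c zero ℕ.* ℤ.∣ z zero ∣)     ∎

module RookSpectrum {N} {A : Matrix N} {m n} (rook : IsRook A (2 ℕ.+ m) (2 ℕ.+ n)) (m≢n : m ≢ n) where

  a = 2 ℕ.+ m
  b = 2 ℕ.+ n

  -- With a = 2 + m and b = 2 + n these are a + b - 2, b - 2, a - 2 and -2, written without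
  -- subtraction; `-[1+ 1 ]` is -2.
  eigenvalues : Fin 4 → ℤ
  eigenvalues zero                   = + (m ℕ.+ b)
  eigenvalues (suc zero)             = + n
  eigenvalues (suc (suc zero))       = + m
  eigenvalues (suc (suc (suc zero))) = -[1+ 1 ]

  multiplicities : Fin 4 → ℕ
  multiplicities zero                   = 1
  multiplicities (suc zero)             = 1 ℕ.+ m
  multiplicities (suc (suc zero))       = 1 ℕ.+ n
  multiplicities (suc (suc (suc zero))) = (1 ℕ.+ m) ℕ.* (1 ℕ.+ n)

  shift : ∀ z → fromℤ (+ 2 ℤ.+ z) ≃ fromℕ 2 +ᴿ fromℤ z
  shift = fromℤ-+ (+ 2)

  a≢b : a ≢ b
  a≢b = m≢n ∘ ℕ.suc-injective ∘ ℕ.suc-injective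

  eigenvalues-injective : ∀ i j → eigenvalues i ≡ eigenvalues j → i ≡ j
  eigenvalues-injective zero zero _ = refl
  eigenvalues-injective (suc zero) (suc zero) _ = refl
  eigenvalues-injective (suc (suc zero)) (suc (suc zero)) _ = refl
  eigenvalues-injective (suc (suc (suc zero))) (suc (suc (suc zero))) _ = refl
  eigenvalues-injective zero (suc zero) eq = contradiction (ℤ.+-injective eq) m+b≢n
    where
    m+b≢n : m ℕ.+ b ≢ n
    m+b≢n eq = ℕ.m≢1+n+m n (sym (trans (cong suc (sym (ℕ.+-suc m n))) (trans (sym (ℕ.+-suc m (suc n))) eq)))
  eigenvalues-injective zero (suc (suc zero)) eq = contradiction (ℤ.+-injective eq) (ℕ.m+1+n≢m m)
  eigenvalues-injective (suc zero) zero eq = contradiction (eigenvalues-injective zero (suc zero) (sym eq)) λ ()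
  eigenvalues-injective (suc (suc zero)) zero eq = contradiction (eigenvalues-injective zero (suc (suc zero)) (sym eq)) λ ()
  eigenvalues-injective (suc zero) (suc (suc zero)) eq = contradiction (sym (ℤ.+-injective eq)) m≢n
  eigenvalues-injective (suc (suc zero)) (suc zero) eq = contradiction (ℤ.+-injective eq) m≢n

  eigenvalues-injective zero             (suc (suc (suc zero))) ()
  eigenvalues-injective (suc zero)       (suc (suc (suc zero))) ()
  eigenvalues-injective (suc (suc zero)) (suc (suc (suc zero))) ()

  dimensions : ∀ i → HasDimension (Eigenspace A (fromℤ (eigenvalues i))) (multiplicities i)
  -- Adding `+ 2` computes to a + b, b, a and 0 respectively, so `shift` has exactly the form that
  -- each dimension lemma expects.
  dimensions zero                   = constant-dimension rook (shift (+ (m ℕ.+ b)))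
  dimensions (suc zero)             = row-dimension rook a≢b (shift (+ n))
  dimensions (suc (suc zero))       = row-dimension (transpose rook) (a≢b ∘ sym) (shift (+ m))
  dimensions (suc (suc (suc zero))) = doublyBalanced-dimension rook (shift -[1+ 1 ])

  spectrum : Spectrum A
  spectrum = record
    { size         = 4
    ; eigenvalue   = fromℤ ∘ eigenvalues
    ; multiplicity = multiplicities
    ; distinct     = λ i j λᵢ≃λⱼ → eigenvalues-injective i j (fromℤ-injective λᵢ≃λⱼ)
    ; sound        = λ
      { zero                   → hasDimension⇒isEigenvalue (dimensions zero)
      ; (suc zero)             → hasDimension⇒isEigenvalue (dimensions (suc zero))
      ; (suc (suc zero))       → hasDimension⇒isEigenvalue (dimensions (suc (suc zero)))
      ; (suc (suc (suc zero))) → hasDimension⇒isEigenvalue (dimensions (suc (suc (suc zero)))) }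
    ; complete     = λ μ μ-eigenvalue → ¬∀≄⇒∃≃ (λ i → eigenvalues i / 1)
        (λ i j eq → eigenvalues-injective i j (/1-injective eq)) μ λ μ≄eigenvalues →
        let excluded : ∀ i → ¬ fromℕ 2 +ᴿ μ ≃ fromℤ (+ 2 ℤ.+ eigenvalues i)
            excluded i eq = μ≄eigenvalues i (+-cancelˡ (fromℕ 2) μ (fromℤ (eigenvalues i)) (≃-trans eq (shift (eigenvalues i))))
        in eigenvalue-cases rook ≃-refl μ-eigenvalue
             (excluded zero , excluded (suc zero) , excluded (suc (suc zero)) , excluded (suc (suc (suc zero))))
    ; dimension    = dimensions
    -- The identity 1 + (a - 1) + (b - 1) + (a - 1)(b - 1) = a b meets the order N through the
    -- bijection `flatten`.
    ; total        = trans
        (solve 2 (λ m n → con 1 :+ ((con 1 :+ m) :+ ((con 1 :+ n) :+ ((con 1 :+ m) :* (con 1 :+ n) :+ con 0)))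
                       := (con 2 :+ m) :* (con 2 :+ n)) refl m n)
        (↔⇒≡ (IsRook.flatten rook))
    }
    where open ℕ.+-*-Solver

  -- Only -2 is negative, contributing 2 (a - 1)(b - 1). The trace being zero, the other three
  -- eigenvalues contribute the same amount, whence the factor 4.
  absoluteSum-spectrum : Spectrum.absoluteSum spectrum ≃ fromℕ (4 ℕ.* ((1 ℕ.+ m) ℕ.* (1 ℕ.+ n)))
  absoluteSum-spectrum = ≃-trans (sum-×-∣fromℤ∣ multiplicities eigenvalues) (≃-reflexive (cong fromℕ
    (solve 2 (λ m n → con 1 :* (m :+ (con 2 :+ n)) :+ ((con 1 :+ m) :* n :+ ((con 1 :+ n) :* m
                        :+ ((con 1 :+ m) :* (con 1 :+ n) :* con 2 :+ con 0)))
                   := con 4 :* ((con 1 :+ m) :* (con 1 :+ n))) refl m n)))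
    where open ℕ.+-*-Solver

-- δ i k + δ j l counts coinciding coordinates; it is 2 on the diagonal, where A vanishes.
entries⇒isRook : ∀ {N} {A : Matrix N} {a b} (grid : Grid N a b) →
  (∀ i j k l → fromℕ 2 *ᴿ (δ i k *ᴿ δ j l) +ᴿ A (Grid.at grid i j) (Grid.at grid k l) ≃ δ i k +ᴿ δ j l) →
  IsRook A a b
entries⇒isRook {A = A} {a} {b} grid entry = record { grid = grid ; action = action }
  where
  open Grid grid
  open ≈-Reasoning ≃-setoid
  open +-*-Solver

  action : ∀ v i j → fromℕ 2 *ᴿ v (at i j) +ᴿ (A ·ᴹ v) (at i j) ≃
                     rowSum (λ k l → v (at k l)) i +ᴿ colSum (λ k l → v (at k l)) j
  action v i j = begin
    -- The diagonal term is spread over the whole board by two deltas, so that `entry` can be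
    -- applied cell by cell under the double sum.
    fromℕ 2 *ᴿ V i j +ᴿ (A ·ᴹ v) (at i j)
      ≈⟨ +-cong (*-cong (≃-refl {fromℕ 2}) (≃-sym sum-δδ)) (sum-grid (λ w → A (at i j) w *ᴿ v w)) ⟩
    fromℕ 2 *ᴿ ∑∑ (λ k l → δ i k *ᴿ (δ j l *ᴿ V k l)) +ᴿ ∑∑ (λ k l → A (at i j) (at k l) *ᴿ V k l)
      ≈⟨ +-cong (*-distribˡ-∑∑ (fromℕ 2) _) ≃-refl ⟩
    ∑∑ (λ k l → fromℕ 2 *ᴿ (δ i k *ᴿ (δ j l *ᴿ V k l))) +ᴿ ∑∑ (λ k l → A (at i j) (at k l) *ᴿ V k l)
      ≈⟨ ∑∑-distrib-+ _ _ ⟨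
    ∑∑ (λ k l → fromℕ 2 *ᴿ (δ i k *ᴿ (δ j l *ᴿ V k l)) +ᴿ A (at i j) (at k l) *ᴿ V k l)
      ≈⟨ ∑∑-cong merge ⟩
    ∑∑ (λ k l → δ i k *ᴿ V k l +ᴿ δ j l *ᴿ V k l)
      ≈⟨ ∑∑-distrib-+ _ _ ⟩
    ∑∑ (λ k l → δ i k *ᴿ V k l) +ᴿ ∑∑ (λ k l → δ j l *ᴿ V k l)
      ≈⟨ +-cong (sum-cong-≋ λ k → *-distribˡ-sum (δ i k) (V k)) ≃-refl ⟨
    sumᴿ (λ k → δ i k *ᴿ rowSum V k) +ᴿ ∑∑ (λ k l → δ j l *ᴿ V k l)
      ≈⟨ +-cong (sum-δ i (rowSum V)) (sum-cong-≋ λ k → sum-δ j (V k)) ⟩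
    rowSum V i +ᴿ colSum V j ∎
    where
    V : Fin a → Fin b → ℝ
    V k l = v (at k l)

    ∑∑ : (Fin a → Fin b → ℝ) → ℝ
    ∑∑ f = sumᴿ λ k → sumᴿ λ l → f k l

    ∑∑-cong : ∀ {f g} → (∀ k l → f k l ≃ g k l) → ∑∑ f ≃ ∑∑ g
    ∑∑-cong f≃g = sum-cong-≋ λ k → sum-cong-≋ (f≃g k)

    ∑∑-distrib-+ : ∀ f g → ∑∑ (λ k l → f k l +ᴿ g k l) ≃ ∑∑ f +ᴿ ∑∑ g
    ∑∑-distrib-+ f g = ≃-trans (sum-cong-≋ λ k → ∑-distrib-+ (f k) (g k)) (∑-distrib-+ (rowSum f) (rowSum g))

    *-distribˡ-∑∑ : ∀ x f → x *ᴿ ∑∑ f ≃ ∑∑ (λ k l → x *ᴿ f k l)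
    *-distribˡ-∑∑ x f = ≃-trans (*-distribˡ-sum x (rowSum f)) (sum-cong-≋ λ k → *-distribˡ-sum x (f k))

    sum-δδ : ∑∑ (λ k l → δ i k *ᴿ (δ j l *ᴿ V k l)) ≃ V i j
    sum-δδ = begin
      ∑∑ (λ k l → δ i k *ᴿ (δ j l *ᴿ V k l))              ≈⟨ sum-cong-≋ (λ k → *-distribˡ-sum (δ i k) (λ l → δ j l *ᴿ V k l)) ⟨
      sumᴿ (λ k → δ i k *ᴿ sumᴿ (λ l → δ j l *ᴿ V k l))   ≈⟨ sum-δ i (λ k → sumᴿ (λ l → δ j l *ᴿ V k l)) ⟩
      sumᴿ (λ l → δ j l *ᴿ V i l)                         ≈⟨ sum-δ j (V i) ⟩
      V i j                                               ∎

    merge : ∀ k l → fromℕ 2 *ᴿ (δ i k *ᴿ (δ j l *ᴿ V k l)) +ᴿ A (at i j) (at k l) *ᴿ V k l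
                  ≃ δ i k *ᴿ V k l +ᴿ δ j l *ᴿ V k l
    merge k l = begin
      fromℕ 2 *ᴿ (δ i k *ᴿ (δ j l *ᴿ V k l)) +ᴿ A (at i j) (at k l) *ᴿ V k l
        ≈⟨ pointwise (λ n → solve 5 (λ t x y z v → t :* (x :* (y :* v)) :+ z :* v := (t :* (x :* y) :+ z) :* v) refl
             (seq (fromℕ 2) n) (seq (δ i k) n) (seq (δ j l) n) (seq (A (at i j) (at k l)) n) (seq (V k l) n)) ⟩
      (fromℕ 2 *ᴿ (δ i k *ᴿ δ j l) +ᴿ A (at i j) (at k l)) *ᴿ V k l
        ≈⟨ *-cong (entry i j k l) (≃-refl {V k l}) ⟩
      (δ i k +ᴿ δ j l) *ᴿ V k l
        ≈⟨ pointwise (λ n → ℚ.*-distribʳ-+ (seq (V k l) n) (seq (δ i k) n) (seq (δ j l) n)) ⟩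
      δ i k *ᴿ V k l +ᴿ δ j l *ᴿ V k l ∎

-- Line graphs of complete bipartite graphs

lookup-injective : ∀ {A : Set} {xs : List A} → Unique xs → ∀ i j → lookup xs i ≡ lookup xs j → i ≡ j
lookup-injective (_     ∷ _)  zero    zero    _  = refl
lookup-injective (x∉xs ∷ _)  zero    (suc j) eq = contradiction eq (All.lookup x∉xs (∈-lookup j))
lookup-injective (x∉xs ∷ _)  (suc i) zero    eq = contradiction (sym eq) (All.lookup x∉xs (∈-lookup i))
lookup-injective (_     ∷ xs) (suc i) (suc j) eq = cong suc (lookup-injective xs i j eq)

if-yes : ∀ {P A : Set} (P? : Dec P) {x y : A} → P → (if ⌊ P? ⌋ then x else y) ≡ x
if-yes (yes _) _ = refl
if-yes (no ¬p) p = contradiction p ¬p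

if-no : ∀ {P A : Set} (P? : Dec P) {x y : A} → ¬ P → (if ⌊ P? ⌋ then x else y) ≡ y
if-no (yes p) ¬p = contradiction p ¬p
if-no (no _)  _  = refl

-- Covering is expressed through edges, in `crossing`, because edges are all that the line graph
-- sees.
record IsCompleteBipartite (G : Graph) (a b : ℕ) : Set where
  open Graph G
  field
    left            : Fin a → Fin order
    right           : Fin b → Fin order
    left-injective  : ∀ {i k} → left i ≡ left k → i ≡ k
    right-injective : ∀ {j l} → right j ≡ right l → j ≡ l
    left≢right      : ∀ i j → left i ≢ right j
    joined          : ∀ i j → Adj (left i) (right j)
    crossing        : ∀ x y → Adj x y → ∃₂ λ i j → (x ≡ left i × y ≡ right j) ⊎ (x ≡ right j × y ≡ left i)

module _ {G : Graph} {a b} (bipartite : IsCompleteBipartite G a b) where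
  open Graph G
  open IsCompleteBipartite bipartite

  private
    Edge = Fin order × Fin order

    edge : Fin (length (edges G)) → Edge
    edge = lookup (edges G)

  -- An edge is listed with its smaller index first, and left vertices need not precede right ones,
  -- so both orientations occur.
  Joins : Fin a → Fin b → Edge → Set
  Joins i j e = e ≡ (left i , right j) ⊎ e ≡ (right j , left i)

  endpoint : ∀ {i j e x} → Joins i j e → _∈ᴱ_ G x e → x ≡ left i ⊎ x ≡ right j
  endpoint (inj₁ refl) x∈e        = x∈e
  endpoint (inj₂ refl) (inj₁ x≡r) = inj₂ x≡r
  endpoint (inj₂ refl) (inj₂ x≡l) = inj₁ x≡l

  left-endpoint : ∀ {i j e} → Joins i j e → _∈ᴱ_ G (left i) e
  left-endpoint (inj₁ refl) = inj₁ refl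
  left-endpoint (inj₂ refl) = inj₂ refl

  right-endpoint : ∀ {i j e} → Joins i j e → _∈ᴱ_ G (right j) e
  right-endpoint (inj₁ refl) = inj₂ refl
  right-endpoint (inj₂ refl) = inj₁ refl

  same-left : ∀ {i j k l e} → Joins i j e → Joins k l e → i ≡ k
  same-left {i} {l = l} joins joins′ =
    [ left-injective , (λ eq → contradiction eq (left≢right i l)) ] (endpoint joins′ (left-endpoint joins))

  same-right : ∀ {i j k l e} → Joins i j e → Joins k l e → j ≡ l
  same-right {j = j} {k} joins joins′ =
    [ (λ eq → contradiction (sym eq) (left≢right k j)) , right-injective ] (endpoint joins′ (right-endpoint joins))

  edges-unique : Unique (edges G)
  edges-unique = Unique.filter⁺ _ (Unique.cartesianProduct⁺ (Unique.allFin⁺ order) (Unique.allFin⁺ order))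

  edge-ordered : ∀ u → proj₁ (edge u) <ᶠ proj₂ (edge u) × Adj (proj₁ (edge u)) (proj₂ (edge u))
  edge-ordered u = proj₂ (∈-filter⁻ _ {xs = cartesianProduct (allFin order) (allFin order)} (∈-lookup u))

  edge-index : ∀ x y → x <ᶠ y → Adj x y → ∃[ u ] edge u ≡ (x , y)
  edge-index x y x<y xy = index xy∈ , sym (lookup-index xy∈)
    where
    xy∈ : (x , y) ∈ edges G
    xy∈ = ∈-filter⁺ (λ (i , j) → (i <ᶠ? j) ×-dec adj? i j) (∈-cartesianProduct⁺ (∈-allFin x) (∈-allFin y)) (x<y , xy)

  edge-between : ∀ i j → ∃[ u ] Joins i j (edge u)
  edge-between i j with <-cmp (left i) (right j)
  ... | tri< l<r _ _ = let u , eq = edge-index _ _ l<r (joined i j) in u , inj₁ eq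
  ... | tri≈ _ l≡r _ = contradiction l≡r (left≢right i j)
  ... | tri> _ _ r<l = let u , eq = edge-index _ _ r<l (symm (joined i j)) in u , inj₂ eq

  ends : ∀ u → ∃₂ λ i j → Joins i j (edge u)
  ends u with crossing _ _ (proj₂ (edge-ordered u))
  ... | i , j , inj₁ (eq₁ , eq₂) = i , j , inj₁ (cong₂ _,_ eq₁ eq₂)
  ... | i , j , inj₂ (eq₁ , eq₂) = i , j , inj₂ (cong₂ _,_ eq₁ eq₂)

  -- With equal orientations, the list of edges has no duplicates; opposite orientations would order
  -- the same two endpoints both ways.
  same-edge : ∀ {i j u w} → Joins i j (edge u) → Joins i j (edge w) → u ≡ w
  same-edge {u = u} {w} (inj₁ eq) (inj₁ eq′) = lookup-injective edges-unique u w (trans eq (sym eq′))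
  same-edge {u = u} {w} (inj₂ eq) (inj₂ eq′) = lookup-injective edges-unique u w (trans eq (sym eq′))
  same-edge {u = u} {w} (inj₁ eq) (inj₂ eq′) = contradiction
    (subst (λ (x , y) → x <ᶠ y) eq′ (proj₁ (edge-ordered w)))
    (<-asym (subst (λ (x , y) → x <ᶠ y) eq (proj₁ (edge-ordered u))))
  same-edge {u = u} {w} (inj₂ eq) (inj₁ eq′) = contradiction
    (subst (λ (x , y) → x <ᶠ y) eq′ (proj₁ (edge-ordered w)))
    (<-asym (subst (λ (x , y) → x <ᶠ y) eq (proj₁ (edge-ordered u))))

  edge-grid : Grid (length (edges G)) a b
  edge-grid = record
    { at         = λ i j → proj₁ (edge-between i j)
    ; row        = λ u → proj₁ (ends u)
    ; col        = λ u → proj₁ (proj₂ (ends u))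
    ; at-row-col = λ u → same-edge (proj₂ (edge-between _ _)) (proj₂ (proj₂ (ends u)))
    ; row-at     = λ i j → same-left (proj₂ (proj₂ (ends _))) (proj₂ (edge-between i j))
    ; col-at     = λ i j → same-right (proj₂ (proj₂ (ends _))) (proj₂ (edge-between i j))
    }

  lineGraph-isRook : IsRook (adjacencyMatrix (lineGraph G)) a b
  lineGraph-isRook = entries⇒isRook edge-grid λ i j k l →
    entry (proj₂ (edge-between i j)) (proj₂ (edge-between k l)) (i ≟ k) (j ≟ l)
    where
    module L = Graph (lineGraph G)
    Entry : Fin a → Fin b → Fin a → Fin b → Fin L.order → Fin L.order → Set
    Entry i j k l u w = fromℕ 2 *ᴿ (δ i k *ᴿ δ j l) +ᴿ adjacencyMatrix (lineGraph G) u w ≃ δ i k +ᴿ δ j l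

    -- Once both deltas and the matrix entry are known constants 0 or 1, the identity 2 d e + m = d
    -- + e is closed rational arithmetic, proved by `refl`.
    entry-value : ∀ {d e m : ℝ} x y z → d ≡ fromℚ x → e ≡ fromℚ y → m ≡ fromℚ z →
                  (+ 2 / 1) ℚ.* (x ℚ.* y) ℚ.+ z ≡ x ℚ.+ y → fromℕ 2 *ᴿ (d *ᴿ e) +ᴿ m ≃ d +ᴿ e
    entry-value x y z refl refl refl eq = pointwise λ _ → eq

    entry : ∀ {i j k l u w} → Joins i j (edge u) → Joins k l (edge w) → Dec (i ≡ k) → Dec (j ≡ l) → Entry i j k l u w
    entry {u = u} {w} joins joins′ (yes i≡k) (yes j≡l) = entry-value 1ℚ 1ℚ 0ℚ (δ-≡ i≡k) (δ-≡ j≡l)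
      (if-no (L.adj? u w) λ (u≢w , _) → u≢w (cong edge (same-edge joins
        (subst₂ (λ k l → Joins k l (edge w)) (sym i≡k) (sym j≡l) joins′)))) refl
    entry {i} {u = u} {w} joins joins′ (yes refl) (no j≢l) = entry-value 1ℚ 0ℚ 1ℚ (δ-≡ {i = i} refl) (δ-≢ j≢l)
      (if-yes (L.adj? u w) ((λ u≡w → j≢l (same-right joins (subst (Joins _ _) (sym u≡w) joins′)))
                           , _ , left-endpoint joins , left-endpoint joins′)) refl
    entry {j = j} {u = u} {w} joins joins′ (no i≢k) (yes refl) = entry-value 0ℚ 1ℚ 1ℚ (δ-≢ i≢k) (δ-≡ {i = j} refl)
      (if-yes (L.adj? u w) ((λ u≡w → i≢k (same-left joins (subst (Joins _ _) (sym u≡w) joins′)))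
                           , _ , right-endpoint joins , right-endpoint joins′)) refl
    entry {i} {j} {k} {l} {u} {w} joins joins′ (no i≢k) (no j≢l) = entry-value 0ℚ 0ℚ 0ℚ (δ-≢ i≢k) (δ-≢ j≢l)
      (if-no (L.adj? u w) λ (_ , x , x∈u , x∈w) → disjoint (endpoint joins x∈u) (endpoint joins′ x∈w)) refl
      where
      disjoint : ∀ {x} → x ≡ left i ⊎ x ≡ right j → ¬ (x ≡ left k ⊎ x ≡ right l)
      disjoint (inj₁ refl) (inj₁ eq) = i≢k (left-injective eq)
      disjoint (inj₁ refl) (inj₂ eq) = left≢right i l eq
      disjoint (inj₂ refl) (inj₁ eq) = left≢right k j (sym eq)
      disjoint (inj₂ refl) (inj₂ eq) = j≢l (right-injective eq)

-- Zero-divisors modulo the product of two primes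

module _ {n : ℕ} .{{_ : NonZero n}} where

  toℕ-0ₙ : toℕ (0ₙ n) ≡ 0
  toℕ-0ₙ = trans (toℕ-fromℕ< (m%n<n 0 n)) (n∣m⇒m%n≡0 0 n (divides 0 refl))

  ≢0ₙ⇒toℕ≢0 : ∀ {x} → x ≢ 0ₙ n → toℕ x ≢ 0
  ≢0ₙ⇒toℕ≢0 x≢0 toℕx≡0 = x≢0 (toℕ-injective (trans toℕx≡0 (sym toℕ-0ₙ)))

  toℕ≢0⇒≢0ₙ : ∀ {x} → toℕ x ≢ 0 → x ≢ 0ₙ n
  toℕ≢0⇒≢0ₙ toℕx≢0 x≡0 = toℕx≢0 (trans (cong toℕ x≡0) toℕ-0ₙ)

  *ₙ≡0⇒∣ : ∀ x y → _*ₙ_ n x y ≡ 0ₙ n → n ∣ toℕ x ℕ.* toℕ y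
  *ₙ≡0⇒∣ x y xy≡0 = m%n≡0⇒n∣m (toℕ x ℕ.* toℕ y) n
    (trans (sym (toℕ-fromℕ< (m%n<n (toℕ x ℕ.* toℕ y) n))) (trans (cong toℕ xy≡0) toℕ-0ₙ))

  ∣⇒*ₙ≡0 : ∀ x y → n ∣ toℕ x ℕ.* toℕ y → _*ₙ_ n x y ≡ 0ₙ n
  ∣⇒*ₙ≡0 x y n∣xy = toℕ-injective (trans (toℕ-fromℕ< (m%n<n (toℕ x ℕ.* toℕ y) n))
    (trans (n∣m⇒m%n≡0 (toℕ x ℕ.* toℕ y) n n∣xy) (sym toℕ-0ₙ)))

  element : Fin (length (nonzeroZeroDivisors n)) → Fin n
  element = lookup (nonzeroZeroDivisors n)

  element-nonzeroZeroDivisor : ∀ u → NonzeroZeroDivisor n (element u)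
  element-nonzeroZeroDivisor u = proj₂ (∈-filter⁻ (nonzeroZeroDivisor? n) {xs = allFin n} (∈-lookup u))

  vertex : ∀ x → NonzeroZeroDivisor n x → ∃[ u ] element u ≡ x
  vertex x x-nzd = index x∈ , sym (lookup-index x∈)
    where
    x∈ : x ∈ nonzeroZeroDivisors n
    x∈ = ∈-filter⁺ (nonzeroZeroDivisor? n) (∈-allFin x) x-nzd

  element-injective : ∀ u w → element u ≡ element w → u ≡ w
  element-injective = lookup-injective (Unique.filter⁺ (nonzeroZeroDivisor? n) (Unique.allFin⁺ n))

module Multiples {n d k} .{{_ : NonZero d}} (dk≡n : d ℕ.* suc k ≡ n) where

  multiple-bound : ∀ (i : Fin k) → d ℕ.* suc (toℕ i) ℕ.< n
  multiple-bound i = subst (d ℕ.* suc (toℕ i) ℕ.<_) dk≡n (ℕ.*-monoʳ-< d (s≤s (toℕ<n i)))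

  -- Index `i` stands for d (i + 1): the shift skips 0 and leaves exactly the n/d - 1 nonzero
  -- multiples.
  multiple : Fin k → Fin n
  multiple i = fromℕ< (multiple-bound i)

  toℕ-multiple : ∀ i → toℕ (multiple i) ≡ d ℕ.* suc (toℕ i)
  toℕ-multiple i = toℕ-fromℕ< (multiple-bound i)

  multiple-injective : ∀ {i j} → multiple i ≡ multiple j → i ≡ j
  multiple-injective {i} {j} eq = toℕ-injective (ℕ.suc-injective (ℕ.*-cancelˡ-≡ _ _ d
    (trans (sym (toℕ-multiple i)) (trans (cong toℕ eq) (toℕ-multiple j)))))

  multiple≢0 : ∀ i → toℕ (multiple i) ≢ 0
  multiple≢0 i eq = ℕ.≢-nonZero⁻¹ (d ℕ.* suc (toℕ i)) {{m*n≢0 d (suc (toℕ i))}} (trans (sym (toℕ-multiple i)) eq)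

  d∣multiple : ∀ i → d ∣ toℕ (multiple i)
  d∣multiple i = subst (d ∣_) (sym (toℕ-multiple i)) (m∣m*n (suc (toℕ i)))

  multiple-surjective : ∀ x → d ∣ toℕ x → toℕ x ≢ 0 → ∃[ i ] x ≡ multiple i
  multiple-surjective x (divides zero    eq) x≢0 = contradiction eq x≢0
  multiple-surjective x (divides (suc c) eq) _ = fromℕ< c<k , toℕ-injective
    (trans x≡d*1+c (sym (trans (toℕ-multiple (fromℕ< c<k)) (cong (λ c → d ℕ.* suc c) (toℕ-fromℕ< c<k)))))
    where
    x≡d*1+c : toℕ x ≡ d ℕ.* suc c
    x≡d*1+c = trans eq (ℕ.*-comm (suc c) d)
    c<k : c ℕ.< k
    c<k = ℕ.s<s⁻¹ (ℕ.*-cancelˡ-< d (suc c) (suc k) (subst₂ ℕ._<_ x≡d*1+c (sym dk≡n) (toℕ<n x)))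

distinct-primes-∤ : ∀ {p q} → Prime p → Prime q → p ≢ q → ¬ p ∣ q
distinct-primes-∤ p-prime q-prime p≢q p∣q with prime⇒irreducible q-prime p∣q
... | inj₁ p≡1 = ℕ.nonTrivial⇒≢1 {{prime⇒nonTrivial p-prime}} p≡1
... | inj₂ p≡q = p≢q p≡q

-- Writing x = c p, the prime q divides c or p, and the latter is impossible for distinct primes.
distinct-primes-*-∣ : ∀ {p q x} → Prime p → Prime q → p ≢ q → p ∣ x → q ∣ x → p ℕ.* q ∣ x
distinct-primes-*-∣ {p} {q} p-prime q-prime p≢q (divides c refl) q∣cp with euclidsLemma c p q-prime q∣cp
... | inj₁ (divides e refl) = divides e (trans (ℕ.*-assoc e q p) (cong (e ℕ.*_) (ℕ.*-comm q p)))
... | inj₂ q∣p              = contradiction q∣p (distinct-primes-∤ q-prime p-prime (p≢q ∘ sym))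

-- The modulus is kept a variable: unfolding the list of zero-divisors of an explicit product is expensive.
module _ {n p q a b} .{{_ : NonZero n}} (p*q≡n : p ℕ.* q ≡ n) (p≡2+a : p ≡ 2 ℕ.+ a) (q≡2+b : q ≡ 2 ℕ.+ b)
         (p-prime : Prime p) (q-prime : Prime q) (p≢q : p ≢ q) where

  -- The multiples of one prime are counted by the other: there are q - 1 = 1 + b multiples of p.
  module P = Multiples {n} {p} {1 ℕ.+ b} {{prime⇒nonZero p-prime}} (trans (cong (p ℕ.*_) (sym q≡2+b)) p*q≡n)
  module Q = Multiples {n} {q} {1 ℕ.+ a} {{prime⇒nonZero q-prime}}
    (trans (cong (q ℕ.*_) (sym p≡2+a)) (trans (ℕ.*-comm q p) p*q≡n))

  n∣x*y : ∀ {x y} → p ∣ x → q ∣ y → n ∣ x ℕ.* y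
  n∣x*y {x} {y} p∣x q∣y = subst (_∣ x ℕ.* y) p*q≡n (*-pres-∣ p∣x q∣y)

  n∣y*x : ∀ {x y} → p ∣ x → q ∣ y → n ∣ y ℕ.* x
  n∣y*x {x} {y} p∣x q∣y = subst (n ∣_) (ℕ.*-comm x y) (n∣x*y p∣x q∣y)

  p-nonzeroZeroDivisor : ∀ j → NonzeroZeroDivisor n (P.multiple j)
  -- The annihilating witness `Q.multiple zero` is q itself.
  p-nonzeroZeroDivisor j = toℕ≢0⇒≢0ₙ (P.multiple≢0 j) , Q.multiple zero , toℕ≢0⇒≢0ₙ (Q.multiple≢0 zero)
    , ∣⇒*ₙ≡0 (P.multiple j) (Q.multiple zero) (n∣x*y (P.d∣multiple j) (Q.d∣multiple zero))

  q-nonzeroZeroDivisor : ∀ i → NonzeroZeroDivisor n (Q.multiple i)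
  q-nonzeroZeroDivisor i = toℕ≢0⇒≢0ₙ (Q.multiple≢0 i) , P.multiple zero , toℕ≢0⇒≢0ₙ (P.multiple≢0 zero)
    , ∣⇒*ₙ≡0 (Q.multiple i) (P.multiple zero) (n∣y*x (P.d∣multiple zero) (Q.d∣multiple i))

  -- Divisibility by both primes gives divisibility by n, impossible for a nonzero residue below n.
  ¬p∣x×q∣x : ∀ (x : Fin n) → toℕ x ≢ 0 → p ∣ toℕ x → ¬ q ∣ toℕ x
  ¬p∣x×q∣x x x≢0 p∣x q∣x = >⇒∤ {{ℕ.≢-nonZero x≢0}} (toℕ<n x)
    (subst (_∣ toℕ x) p*q≡n (distinct-primes-*-∣ p-prime q-prime p≢q p∣x q∣x))

  -- Each prime divides one of the two factors by Euclid's lemma, and they cannot both divide the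
  -- same one. This is what makes every edge cross between the two sides.
  factors : ∀ (x y : Fin n) → toℕ x ≢ 0 → toℕ y ≢ 0 → n ∣ toℕ x ℕ.* toℕ y →
            ((q ∣ toℕ x) × (p ∣ toℕ y)) ⊎ ((p ∣ toℕ x) × (q ∣ toℕ y))
  factors x y x≢0 y≢0 n∣xy with euclidsLemma (toℕ x) (toℕ y) p-prime (∣-trans (subst (p ∣_) p*q≡n (m∣m*n q)) n∣xy)
                              | euclidsLemma (toℕ x) (toℕ y) q-prime (∣-trans (subst (q ∣_) p*q≡n (n∣m*n p)) n∣xy)
  ... | inj₁ p∣x | inj₁ q∣x = contradiction q∣x (¬p∣x×q∣x x x≢0 p∣x)
  ... | inj₁ p∣x | inj₂ q∣y = inj₂ (p∣x , q∣y)
  ... | inj₂ p∣y | inj₁ q∣x = inj₁ (q∣x , p∣y)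
  ... | inj₂ p∣y | inj₂ q∣y = contradiction q∣y (¬p∣x×q∣x y y≢0 p∣y)

  zeroDivisorGraph-isCompleteBipartite : IsCompleteBipartite (zeroDivisorGraph n) (1 ℕ.+ a) (1 ℕ.+ b)
  zeroDivisorGraph-isCompleteBipartite = record
    { left            = left
    ; right           = right
    ; left-injective  = λ {i} {k} eq → Q.multiple-injective
        (trans (sym (element-left i)) (trans (cong element eq) (element-left k)))
    ; right-injective = λ {j} {l} eq → P.multiple-injective
        (trans (sym (element-right j)) (trans (cong element eq) (element-right l)))
    ; left≢right      = λ i j → left≢right i j ∘ cong element
    ; joined          = λ i j → left≢right i j , ∣⇒*ₙ≡0 (element (left i)) (element (right j))
        (n∣y*x (subst (λ x → p ∣ toℕ x) (sym (element-right j)) (P.d∣multiple j))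
               (subst (λ x → q ∣ toℕ x) (sym (element-left i)) (Q.d∣multiple i)))
    ; crossing        = crossing
    }
    where
    left : Fin (1 ℕ.+ a) → Fin (length (nonzeroZeroDivisors n))
    left i = proj₁ (vertex (Q.multiple i) (q-nonzeroZeroDivisor i))

    element-left : ∀ i → element (left i) ≡ Q.multiple i
    element-left i = proj₂ (vertex (Q.multiple i) (q-nonzeroZeroDivisor i))

    right : Fin (1 ℕ.+ b) → Fin (length (nonzeroZeroDivisors n))
    right j = proj₁ (vertex (P.multiple j) (p-nonzeroZeroDivisor j))

    element-right : ∀ j → element (right j) ≡ P.multiple j
    element-right j = proj₂ (vertex (P.multiple j) (p-nonzeroZeroDivisor j))

    left≢right : ∀ i j → element (left i) ≢ element (right j)
    left≢right i j eq = ¬p∣x×q∣x (Q.multiple i) (Q.multiple≢0 i)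
      (subst (λ x → p ∣ toℕ x) (sym (trans (sym (element-left i)) (trans eq (element-right j)))) (P.d∣multiple j))
      (Q.d∣multiple i)

    nonzero : ∀ u → toℕ (element u) ≢ 0
    nonzero u = ≢0ₙ⇒toℕ≢0 (proj₁ (element-nonzeroZeroDivisor u))

    is-left : ∀ u → q ∣ toℕ (element u) → ∃[ i ] u ≡ left i
    is-left u q∣u =
      let i , eq = Q.multiple-surjective (element u) q∣u (nonzero u)
      in i , element-injective u (left i) (trans eq (sym (element-left i)))

    is-right : ∀ u → p ∣ toℕ (element u) → ∃[ j ] u ≡ right j
    is-right u p∣u =
      let j , eq = P.multiple-surjective (element u) p∣u (nonzero u)
      in j , element-injective u (right j) (trans eq (sym (element-right j)))

    crossing : ∀ u w → Graph.Adj (zeroDivisorGraph n) u w →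
               ∃₂ λ i j → (u ≡ left i × w ≡ right j) ⊎ (u ≡ right j × w ≡ left i)
    crossing u w (_ , uw≡0)
      with factors (element u) (element w) (nonzero u) (nonzero w) (*ₙ≡0⇒∣ (element u) (element w) uw≡0)
    ... | inj₁ (q∣u , p∣w) =
      let i , u≡l = is-left u q∣u ; j , w≡r = is-right w p∣w in i , j , inj₁ (u≡l , w≡r)
    ... | inj₂ (p∣u , q∣w) =
      let j , u≡r = is-right u p∣u ; i , w≡l = is-left w q∣w in i , j , inj₂ (u≡r , w≡l)

-- The energy as a polynomial in the two primes.

formula : ℤ → ℤ → ℤ
formula p q = + 4 * p * q - + 8 * p - + 8 * q + + 16

-- Under p = 3 + m and q = 3 + k both sides are 4 (p - 2)(q - 2).
formula-shifted : ∀ m k → + 4 * ((+ 1 + m) * (+ 1 + k)) ≡ formula (+ 3 + m) (+ 3 + k)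
formula-shifted = solve 2 (λ m k →
  con (+ 4) :* ((con (+ 1) :+ m) :* (con (+ 1) :+ k)) :=
  con (+ 4) :* (con (+ 3) :+ m) :* (con (+ 3) :+ k) :- con (+ 8) :* (con (+ 3) :+ m)
    :- con (+ 8) :* (con (+ 3) :+ k) :+ con (+ 16)) refl
  where open ℤ.+-*-Solver

total-energy : ∀ {p q m k} → p ≡ 3 ℕ.+ m → q ≡ 3 ℕ.+ k → + (4 ℕ.* ((1 ℕ.+ m) ℕ.* (1 ℕ.+ k))) ≡ formula (+ p) (+ q)
total-energy {p} {q} {m} {k} p≡3+m q≡3+k = begin
    + (4 ℕ.* ((1 ℕ.+ m) ℕ.* (1 ℕ.+ k)))  ≡⟨ ℤ.pos-* 4 ((1 ℕ.+ m) ℕ.* (1 ℕ.+ k)) ⟩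
    + 4 * + ((1 ℕ.+ m) ℕ.* (1 ℕ.+ k))    ≡⟨ cong (+ 4 *_) (ℤ.pos-* (1 ℕ.+ m) (1 ℕ.+ k)) ⟩
    + 4 * ((+ 1 + + m) * (+ 1 + + k))    ≡⟨ formula-shifted (+ m) (+ k) ⟩
    formula (+ 3 + + m) (+ 3 + + k)      ≡⟨ cong₂ formula (cong +_ p≡3+m) (cong +_ q≡3+k) ⟨
    formula (+ p) (+ q)                  ∎
    where open ≡-Reasoning

energy : ∀ n .{{_ : NonZero n}} p q → p ℕ.* q ≡ n → Prime p → Prime q → p ≢ q → p > 2 → q > 2 →
  IsEnergy (lineGraph (zeroDivisorGraph n)) (fromℤ (+ 4 * + p * + q - + 8 * + p - + 8 * + q + + 16))
energy n p q p*q≡n p-prime q-prime p≢q p>2 q>2 =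
  spectrum , ≃-trans absoluteSum-spectrum (≃-reflexive (cong fromℤ (total-energy p≡3+m q≡3+k)))
  where
  -- The board has side p - 1, which `RookSpectrum` wants as 2 + m; the bipartite graph is
  -- accordingly taken with `a` = p - 2 = 1 + m.
  m = p ℕ.∸ 3
  k = q ℕ.∸ 3
  p≡3+m : p ≡ 3 ℕ.+ m
  p≡3+m = sym (ℕ.m+[n∸m]≡n p>2)
  q≡3+k : q ≡ 3 ℕ.+ k
  q≡3+k = sym (ℕ.m+[n∸m]≡n q>2)
  open RookSpectrum
    (lineGraph-isRook (zeroDivisorGraph-isCompleteBipartite {a = 1 ℕ.+ m} {1 ℕ.+ k} p*q≡n p≡3+m q≡3+k p-prime q-prime p≢q))
    (λ m≡k → p≢q (trans p≡3+m (trans (cong (3 ℕ.+_) m≡k) (sym q≡3+k))))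

theorem3p3 : (p q : ℕ) (p-prime : Prime p) (q-prime : Prime q) → p ≢ q → p > 2 → q > 2 →
    let instance pq≢0 = m*n≢0 p q {{prime⇒nonZero p-prime}} {{prime⇒nonZero q-prime}} in
    IsEnergy (lineGraph (zeroDivisorGraph (p ℕ.* q)))
    (fromℤ (+ 4 * + p * + q - + 8 * + p - + 8 * + q + + 16))
theorem3p3 p q p-prime q-prime =
  energy (p ℕ.* q) {{m*n≢0 p q {{prime⇒nonZero p-prime}} {{prime⇒nonZero q-prime}}}} p q refl p-prime q-prime
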